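{- Let $P_n(x)=\sum_{\sigma\in\mathfrak{S}_n}x^{\mathrm{wexx}(\sigma)}$ and $Q_n(x)=\sum_{\sigma\in\mathfrak{S}_n}x^{\mathrm{cdes}(\sigma)}$. Then both $\sum_{n\ge0}P_n(x)t^n$ and $\sum_{n\ge0}Q_n(x)t^n$ equal the Jacobi-type continued fraction $$\cfrac{1}{1-1\cdot t-\cfrac{1\cdot1\,t^2}{1-(2+x)t-\cfrac{2(1+x)t^2}{1-(3+2x)t-\cfrac{3(1+2x)t^2}{1-\cdots}}}}$$ with coefficients $\gamma_n=(n+1)+nx$ for $n\ge0$ and $\beta_n=n\,(1+(n-1)x)$ for $n\ge1$. Consequently $P_n(x)=Q_n(x)$ for all $n\ge0$, i.e. the statistics wexx and cdes are equidistributed on $\mathfrak{S}_n$.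
   Context: $\mathfrak{S}_n$ is the set of permutations of $[n]$. $\mathrm{wexx}(\sigma)$ is the number of $j\in[n]$ with $j\le\sigma(j)$ such that there exist $i<j<k$ with $\sigma(i)>\sigma(j)>\sigma(k)$ (weak excedances that are midpoints of a decreasing subsequence of length 3). $\mathrm{cdes}(\sigma)$ (cycle descent number) is the number of $i\in[n]$ with $i>\sigma(i)$ such that $\sigma(i)$ is not the smallest element of its cycle. The Jacobi-type continued fraction with coefficients $(\gamma_n)_{n\ge0},(\beta_n)_{n\ge1}$ is $1/(1-\gamma_0t-\beta_1t^2/(1-\gamma_1t-\beta_2t^2/(1-\cdots)))$. -}

module Defs where

open import Data.Nat using (ℕ; zero; suc; _+_; _*_; _∸_; _≡ᵇ_; _<ᵇ_)
open import Data.Bool using (Bool; true; false; not; _∧_; _∨_; if_then_else_)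
open import Data.Fin using (Fin; toℕ)
open import Data.Vec using (Vec; []; _∷_; lookup)
open import Data.List using (List; []; _∷_; map; concatMap; allFin; length; upTo)
open import Data.Bool.ListAction using (all; any)
open import Data.Nat.ListAction using (sum)

-- Permutations of [n], realised on Fin n = {0,…,n-1} (shift by one of
-- [n] = {1,…,n}; all statistics below only compare values, so the shift
-- is harmless).

allVecs : (n m : ℕ) → List (Vec (Fin n) m)
allVecs n zero    = [] ∷ []
allVecs n (suc m) = concatMap (λ v → map (λ a → a ∷ v) (allFin n)) (allVecs n m)

filterᵇ : {A : Set} → (A → Bool) → List A → List A
filterᵇ p []       = []
filterᵇ p (x ∷ xs) = if p x then x ∷ filterᵇ p xs else filterᵇ p xs

_=ᶠ_ : {n : ℕ} → Fin n → Fin n → Bool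
i =ᶠ j = toℕ i ≡ᵇ toℕ j

_<ᶠ_ : {n : ℕ} → Fin n → Fin n → Bool
i <ᶠ j = toℕ i <ᵇ toℕ j

isInjective : (n : ℕ) → (Fin n → Fin n) → Bool
isInjective n f = all (λ i → all (λ j → not (f i =ᶠ f j) ∨ (i =ᶠ j)) (allFin n)) (allFin n)

perms : (n : ℕ) → List (Fin n → Fin n)
perms n = map lookup (filterᵇ (λ v → isInjective n (lookup v)) (allVecs n n))

isMid321 : (n : ℕ) → (Fin n → Fin n) → Fin n → Bool
isMid321 n σ j =
  any (λ i → (i <ᶠ j) ∧ (σ j <ᶠ σ i)) (allFin n) ∧
  any (λ k → (j <ᶠ k) ∧ (σ k <ᶠ σ j)) (allFin n)

isWex : (n : ℕ) → (Fin n → Fin n) → Fin n → Bool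
isWex n σ j = not (σ j <ᶠ j)

countᵇ : {A : Set} → (A → Bool) → List A → ℕ
countᵇ p xs = length (filterᵇ p xs)

wexx : (n : ℕ) → (Fin n → Fin n) → ℕ
wexx n σ = countᵇ (λ j → isWex n σ j ∧ isMid321 n σ j) (allFin n)

iter : {n : ℕ} → (Fin n → Fin n) → ℕ → Fin n → Fin n
iter σ zero    a = a
iter σ (suc m) a = σ (iter σ m a)

cycleOf : (n : ℕ) → (Fin n → Fin n) → Fin n → List (Fin n)
cycleOf n σ a = map (λ m → iter σ m a) (upTo n)

notCycleMin : (n : ℕ) → (Fin n → Fin n) → Fin n → Bool
notCycleMin n σ a = any (λ b → b <ᶠ a) (cycleOf n σ a)

cdes : (n : ℕ) → (Fin n → Fin n) → ℕ
cdes n σ = countᵇ (λ i → (σ i <ᶠ i) ∧ notCycleMin n σ (σ i)) (allFin n)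

-- Bivariate series in t and x with ℕ coefficients:
-- F n k = coefficient of t^n x^k.

Series : Set
Series = ℕ → ℕ → ℕ

P : Series
P n k = countᵇ (λ σ → wexx n σ ≡ᵇ k) (perms n)

Q : Series
Q n k = countᵇ (λ σ → cdes n σ ≡ᵇ k) (perms n)

Σ≤ : ℕ → (ℕ → ℕ) → ℕ
Σ≤ n f = sum (map f (upTo (suc n)))

_⊛_ : Series → Series → Series
(f ⊛ g) n k = Σ≤ n (λ i → Σ≤ k (λ j → f i j * g (n ∸ i) (k ∸ j)))

_⊕_ : Series → Series → Series
(f ⊕ g) n k = f n k + g n k

oneS : Series
oneS zero zero = 1
oneS _    _    = 0

tS : Series → Series
tS f zero    k = 0
tS f (suc n) k = f n k

constS : (ℕ → ℕ) → Series
constS p zero    k = p k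
constS p (suc n) k = 0

powS : Series → ℕ → Series
powS g zero    = oneS
powS g (suc r) = g ⊛ powS g r

-- 1/(1-g) for g with zero constant term in t: Σ_r g^r
-- (only r ≤ n contributes to t^n)
inv1m : Series → Series
inv1m g n k = Σ≤ n (λ r → powS g r n k)

γ : ℕ → ℕ → ℕ
γ m zero          = suc m
γ m (suc zero)    = m
γ m (suc (suc _)) = 0

β : ℕ → ℕ → ℕ
β m zero          = m
β m (suc zero)    = m * (m ∸ 1)
β m (suc (suc _)) = 0

-- Depth-d convergent of the J-fraction starting at level m:
-- J 0 m = 1,  J (d+1) m = 1/(1 - γ_m t - β_{m+1} t² J d (m+1)).
-- For d ≥ n the coefficient of t^n of J d 0 equals that of the infinite
-- J-fraction.
J : ℕ → ℕ → Series
J zero    m = oneS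
J (suc d) m = inv1m (tS (constS (γ m)) ⊕ tS (tS (constS (β (suc m)) ⊛ J d (suc m))))

{-# OPTIONS --safe #-}
-- Both generating functions are shown to count weighted Motzkin paths: if X s h satisfies
--   X (s+1) (h+1) = u_h X s h + γ_{h+1} X s (h+1) + v_{h+1} X s (h+2),  u_h v_h = β_{h+1},
-- with X 0 h = [h = 0], then Σ X s 0 t^s is the J-fraction.
--
-- wexx counts the weak excedances that are not left-to-right maxima.  Let X s h sum x^wexx over
-- the permutations of s + h points that send the first h positions to values ≥ h (the h open
-- positions and h open values after part of the permutation has been read and deleted).
-- Deciding first the position h and then the value h, and deleting what has been matched,
-- gives u_h = β_{h+1} and v_h = 1: a value placed in an open position is a record exactly when
-- that position is the leftmost one.
--
-- For cdes, insert a new maximum after i in the cycle of i: an excedance i raises cdes by one and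
-- keeps exc, any other i keeps cdes and raises exc, a new fixed point changes neither.  Let X s h be
-- the coefficient of z^h in Σ x^cdes (1+xz)^exc (1+z)^(s-exc) over permutations of s points.
-- The insertion acts on it as (1+z) + (1+z)(1+xz) d/dz, which gives u_h = 1 + hx and v_h = h + 1.
module Submission where

open import Defs
open import Algebra using (CommutativeSemiring)
import Algebra.Properties.CommutativeMonoid.Sum as Sum
import Algebra.Properties.CommutativeSemigroup as CommutativeSemigroup
import Algebra.Solver.Ring.NaturalCoefficients.Default as Solver
open import Algebra.Structures.Biased using (isCommutativeSemiringˡ)
open import Data.Bool using (Bool; true; false; not; _∧_; _∨_; T; if_then_else_)
open import Data.Bool.ListAction using (all; any)
open import Data.Bool.Properties using (T?; T-∧)
open import Data.Empty using (⊥-elim)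
open import Data.Fin using (Fin; zero; suc; toℕ; fromℕ; fromℕ<; inject; inject₁; punchIn; punchOut)
open import Data.Fin.Permutation.Components using (transpose; transpose-inverse)
open import Data.Fin.Properties using (_≟_; all?; any?; toℕ-injective; toℕ<n; toℕ≤pred[n]; toℕ-fromℕ; toℕ-fromℕ<; toℕ-inject; toℕ-inject₁; inject₁-injective; fromℕ≢inject₁; punchIn-injective; punchInᵢ≢i; punchIn-mono-≤; punchIn-cancel-≤; punchIn-punchOut; punchOut-injective; injective⇒≤; pigeonhole)
open import Data.Fin.Relation.Unary.Top using (view; ‵fromℕ; ‵inject₁)
open import Data.List using (List; []; _∷_; _++_; map; concatMap; filter; allFin; tabulate; cartesianProductWith)
open import Data.List.Membership.Propositional using (_∈_; find; lose)
open import Data.List.Membership.Propositional.Properties using (∈-allFin; ∈-upTo⁺; ∈-filter⁺; ∈-filter⁻; ∈-cartesianProductWith⁺; ∈-cartesianProductWith⁻)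
open import Data.List.Membership.Propositional.Properties.WithK using (unique∧set⇒bag)
open import Data.List.Properties using (map-applyUpTo; map-upTo)
open import Data.List.Relation.Binary.BagAndSetEquality using (∼bag⇒↭)
open import Data.List.Relation.Binary.Permutation.Propositional as ↭ using (_↭_)
open import Data.List.Relation.Unary.All as All using ()
open import Data.List.Relation.Unary.All.Properties using (all⁺; all⁻)
import Data.List.Relation.Unary.AllPairs as AllPairs
open import Data.List.Relation.Unary.Any using (here; there)
open import Data.List.Relation.Unary.Any.Properties using (any⁺; any⁻) renaming (map⁺ to Any-map⁺; map⁻ to Any-map⁻)
open import Data.List.Relation.Unary.Unique.Propositional using (Unique)
open import Data.List.Relation.Unary.Unique.Propositional.Properties using (allFin⁺; filter⁺; cartesianProductWith⁺)
open import Data.Nat using (ℕ; zero; suc; _≤_; _<_; z≤n; s≤s; s≤s⁻¹; _∸_; _≤?_; _<?_; _≡ᵇ_) renaming (_+_ to _+ℕ_; _*_ to _*ℕ_)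
open import Data.Nat.Induction using (<-rec)
import Data.Nat.ListAction as ListAction
import Data.Nat.Properties as ℕ
open import Data.Product using (∃; _×_; _,_; proj₁; proj₂)
open import Data.Sum using (_⊎_; inj₁; inj₂)
open import Data.Vec as Vec using (Vec; []; _∷_; lookup; insertAt)
open import Data.Vec.Properties using (∷-injective; insertAt-lookup; insertAt-punchIn; lookup-map; lookup∘tabulate; tabulate∘lookup; tabulate-cong)
open import Function using (_∘_; id; flip; _⇔_; mk⇔; Equivalence)
open import Level using (0ℓ)
open import Relation.Binary using (IsEquivalence)
open import Relation.Binary.PropositionalEquality as ≡ using (_≡_; _≢_; refl; sym; trans; cong; cong₂; subst; subst₂)
open import Relation.Nullary using (Dec; yes; no; does; ¬_; contradiction)
open import Relation.Nullary.Decidable using (_×-dec_; _→-dec_; ¬?; dec-true; dec-false)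

open Equivalence using (to; from)

-- All coefficients are natural numbers, so nothing is ever subtracted: 1/(1 - g) is used through F
-- = 1 + gF, a difference of two classes of permutations through a conjunction with a negation, and
-- s - exc is a statistic of its own. No bijection of permutations links the two statistics. They
-- agree because a path from height 0 back to 0 climbs each edge as often as it descends it, so only
-- the products u_h v_h matter. For wexx, a weak excedance with a larger value before it always has
-- a smaller value after it. The condition then looks to the left only, which makes it insensitive
-- to the deletions. For cdes, the number of insertions of each kind depends on exc, so the sum of
-- x^cdes alone satisfies no recurrence. The factors are chosen because (1+z)(1+xz) d/dz multiplies
-- (1+xz)^e (1+z)^f by ex(1+z) + f(1+xz). This is the effect of inserting after the e excedances (a
-- factor x, one more non-excedance) and after the f others (one more excedance). Extracting [z^h]
-- leaves coefficients that depend on h alone.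

module ℕΣ = Sum ℕ.+-0-commutativeMonoid
module ℕ+ = CommutativeSemigroup ℕ.+-commutativeSemigroup

-- Formal power series

module PowerSeries (R : CommutativeSemiring 0ℓ 0ℓ) where
  open CommutativeSemiring R hiding (zero) renaming (refl to ≈-refl; sym to ≈-sym; trans to ≈-trans)
  open import Relation.Binary.Reasoning.Setoid setoid
  open Solver R using (solve; _:=_; _:+_; _:*_)

  infix 4 _≈ᵖ_
  infixl 6 _+ᵖ_
  infixl 7 _*ᵖ_ _·ᵖ_

  _≈ᵖ_ : (f g : ℕ → Carrier) → Set
  f ≈ᵖ g = ∀ n → f n ≈ g n

  _+ᵖ_ : (f g : ℕ → Carrier) → ℕ → Carrier
  (f +ᵖ g) n = f n + g n

  _·ᵖ_ : Carrier → (ℕ → Carrier) → ℕ → Carrier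
  (a ·ᵖ f) n = a * f n

  _*ᵖ_ : (f g : ℕ → Carrier) → ℕ → Carrier
  (f *ᵖ g) zero    = f 0 * g 0
  (f *ᵖ g) (suc n) = f 0 * g (suc n) + ((f ∘ suc) *ᵖ g) n

  constᵖ : Carrier → ℕ → Carrier
  constᵖ a zero    = a
  constᵖ a (suc n) = 0#

  tᵖ : (ℕ → Carrier) → ℕ → Carrier
  tᵖ f zero    = 0#
  tᵖ f (suc n) = f n

  0ᵖ 1ᵖ : ℕ → Carrier
  0ᵖ n = 0#
  1ᵖ = constᵖ 1#

  *ᵖ-cong : ∀ {f f′ g g′} → f ≈ᵖ f′ → g ≈ᵖ g′ → f *ᵖ g ≈ᵖ f′ *ᵖ g′
  *ᵖ-cong p q zero    = *-cong (p 0) (q 0)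
  *ᵖ-cong p q (suc n) = +-cong (*-cong (p 0) (q (suc n))) (*ᵖ-cong (p ∘ suc) q n)

  *ᵖ-cong-≤ : ∀ f {g g′} n → (∀ i → i ≤ n → g i ≈ g′ i) → (f *ᵖ g) n ≈ (f *ᵖ g′) n
  *ᵖ-cong-≤ f zero    p = *-congˡ (p 0 z≤n)
  *ᵖ-cong-≤ f (suc n) p =
    +-cong (*-congˡ (p (suc n) ℕ.≤-refl)) (*ᵖ-cong-≤ (f ∘ suc) n (λ i i≤n → p i (ℕ.m≤n⇒m≤1+n i≤n)))

  *ᵖ-zeroˡ : ∀ f → 0ᵖ *ᵖ f ≈ᵖ 0ᵖ
  *ᵖ-zeroˡ f zero    = zeroˡ _
  *ᵖ-zeroˡ f (suc n) = ≈-trans (+-cong (zeroˡ _) (*ᵖ-zeroˡ f n)) (+-identityˡ _)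

  constᵖ-* : ∀ a f → constᵖ a *ᵖ f ≈ᵖ a ·ᵖ f
  constᵖ-* a f zero    = ≈-refl
  constᵖ-* a f (suc n) = ≈-trans (+-congˡ (*ᵖ-zeroˡ f n)) (+-identityʳ _)

  *ᵖ-identityˡ : ∀ f → 1ᵖ *ᵖ f ≈ᵖ f
  *ᵖ-identityˡ f n = ≈-trans (constᵖ-* 1# f n) (*-identityˡ _)

  *ᵖ-distribʳ : ∀ f g h → (g +ᵖ h) *ᵖ f ≈ᵖ g *ᵖ f +ᵖ h *ᵖ f
  *ᵖ-distribʳ f g h zero    = distribʳ _ _ _
  *ᵖ-distribʳ f g h (suc n) = begin
    (g 0 + h 0) * f (suc n) + ((g ∘ suc +ᵖ h ∘ suc) *ᵖ f) n
      ≈⟨ +-congˡ (*ᵖ-distribʳ f (g ∘ suc) (h ∘ suc) n) ⟩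
    (g 0 + h 0) * f (suc n) + (((g ∘ suc) *ᵖ f) n + ((h ∘ suc) *ᵖ f) n)
      ≈⟨ solve 5 (λ a b c d e → (a :+ b) :* c :+ (d :+ e) := (a :* c :+ d) :+ (b :* c :+ e)) ≈-refl _ _ _ _ _ ⟩
    (g *ᵖ f) (suc n) + (h *ᵖ f) (suc n) ∎

  ·ᵖ-*ᵖ : ∀ a f g → (a ·ᵖ f) *ᵖ g ≈ᵖ a ·ᵖ (f *ᵖ g)
  ·ᵖ-*ᵖ a f g zero    = *-assoc _ _ _
  ·ᵖ-*ᵖ a f g (suc n) =
    ≈-trans (+-cong (*-assoc _ _ _) (·ᵖ-*ᵖ a (f ∘ suc) g n)) (≈-sym (distribˡ _ _ _))

  *ᵖ-assoc : ∀ f g h → (f *ᵖ g) *ᵖ h ≈ᵖ f *ᵖ (g *ᵖ h)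
  *ᵖ-assoc f g h zero    = *-assoc _ _ _
  *ᵖ-assoc f g h (suc n) = begin
    f 0 * g 0 * h (suc n) + ((f 0 ·ᵖ (g ∘ suc) +ᵖ (f ∘ suc) *ᵖ g) *ᵖ h) n
      ≈⟨ +-congˡ (*ᵖ-distribʳ h (f 0 ·ᵖ (g ∘ suc)) ((f ∘ suc) *ᵖ g) n) ⟩
    f 0 * g 0 * h (suc n) + (((f 0 ·ᵖ (g ∘ suc)) *ᵖ h) n + (((f ∘ suc) *ᵖ g) *ᵖ h) n)
      ≈⟨ +-congˡ (+-cong (·ᵖ-*ᵖ (f 0) (g ∘ suc) h n) (*ᵖ-assoc (f ∘ suc) g h n)) ⟩
    f 0 * g 0 * h (suc n) + (f 0 * ((g ∘ suc) *ᵖ h) n + ((f ∘ suc) *ᵖ (g *ᵖ h)) n)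
      ≈⟨ solve 5 (λ a b c d e → a :* b :* c :+ (a :* d :+ e) := a :* (b :* c :+ d) :+ e) ≈-refl _ _ _ _ _ ⟩
    (f *ᵖ (g *ᵖ h)) (suc n) ∎

  tᵖ-cong : ∀ {f g} → f ≈ᵖ g → tᵖ f ≈ᵖ tᵖ g
  tᵖ-cong p zero    = ≈-refl
  tᵖ-cong p (suc n) = p n

  tᵖ-* : ∀ f g → tᵖ f *ᵖ g ≈ᵖ tᵖ (f *ᵖ g)
  tᵖ-* f g zero    = zeroˡ _
  tᵖ-* f g (suc n) = ≈-trans (+-congʳ (zeroˡ _)) (+-identityˡ _)

  *ᵖ-sucʳ : ∀ f g n → (f *ᵖ g) (suc n) ≈ f (suc n) * g 0 + (f *ᵖ (g ∘ suc)) n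
  *ᵖ-sucʳ f g zero    = +-comm _ _
  *ᵖ-sucʳ f g (suc n) = begin
    f 0 * g (suc (suc n)) + ((f ∘ suc) *ᵖ g) (suc n)
      ≈⟨ +-congˡ (*ᵖ-sucʳ (f ∘ suc) g n) ⟩
    f 0 * g (suc (suc n)) + (f (suc (suc n)) * g 0 + ((f ∘ suc) *ᵖ (g ∘ suc)) n)
      ≈⟨ solve 3 (λ a b c → a :+ (b :+ c) := b :+ (a :+ c)) ≈-refl _ _ _ ⟩
    f (suc (suc n)) * g 0 + (f *ᵖ (g ∘ suc)) (suc n) ∎

  *ᵖ-comm : ∀ f g → f *ᵖ g ≈ᵖ g *ᵖ f
  *ᵖ-comm f g zero    = *-comm _ _
  *ᵖ-comm f g (suc n) = begin
    f 0 * g (suc n) + ((f ∘ suc) *ᵖ g) n  ≈⟨ +-cong (*-comm _ _) (*ᵖ-comm (f ∘ suc) g n) ⟩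
    g (suc n) * f 0 + (g *ᵖ (f ∘ suc)) n  ≈⟨ *ᵖ-sucʳ g f n ⟨
    (g *ᵖ f) (suc n)                      ∎

  commutativeSemiring : CommutativeSemiring 0ℓ 0ℓ
  commutativeSemiring = record
    { Carrier = ℕ → Carrier
    ; _≈_ = _≈ᵖ_
    ; _+_ = _+ᵖ_
    ; _*_ = _*ᵖ_
    ; 0# = 0ᵖ
    ; 1# = 1ᵖ
    ; isCommutativeSemiring = isCommutativeSemiringˡ record
      { +-isCommutativeMonoid = record
        { isMonoid = record
          { isSemigroup = record
            { isMagma = record
              { isEquivalence = isEquivalenceᵖ
              ; ∙-cong = λ p q n → +-cong (p n) (q n)
              }
            ; assoc = λ f g h n → +-assoc _ _ _
            }
          ; identity = (λ f n → +-identityˡ _) , (λ f n → +-identityʳ _)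
          }
        ; comm = λ f g n → +-comm _ _
        }
      ; *-isCommutativeMonoid = record
        { isMonoid = record
          { isSemigroup = record
            { isMagma = record
              { isEquivalence = isEquivalenceᵖ
              ; ∙-cong = *ᵖ-cong
              }
            ; assoc = *ᵖ-assoc
            }
          ; identity = *ᵖ-identityˡ , λ f n → ≈-trans (*ᵖ-comm f 1ᵖ n) (*ᵖ-identityˡ f n)
          }
        ; comm = *ᵖ-comm
        }
      ; distribʳ = *ᵖ-distribʳ
      ; zeroˡ = *ᵖ-zeroˡ
      }
    }
    where
    isEquivalenceᵖ : IsEquivalence _≈ᵖ_
    isEquivalenceᵖ = record
      { refl = λ n → ≈-refl
      ; sym = λ p n → ≈-sym (p n)
      ; trans = λ p q n → ≈-trans (p n) (q n)
      }

-- Jacobi continued fractions and weighted Motzkin paths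

module JFraction (R : CommutativeSemiring 0ℓ 0ℓ) where
  open CommutativeSemiring R hiding (zero) renaming (refl to ≈-refl; sym to ≈-sym; trans to ≈-trans)
  open PowerSeries R
  open import Relation.Binary.Reasoning.Setoid setoid
  open Solver R using (solve; _:=_; _:+_; _:*_)

  -- Without subtraction the inverse 1/(1 - tg) is described by the equation F = 1 + tgF, which
  -- determines F coefficient by coefficient.
  module Convergents
    (c b : ℕ → Carrier) (J : ℕ → ℕ → ℕ → Carrier)
    (J-zero : ∀ m → J 0 m ≈ᵖ 1ᵖ)
    (J-suc : ∀ d m → J (suc d) m ≈ᵖ
      1ᵖ +ᵖ tᵖ ((constᵖ (c m) +ᵖ tᵖ (b m ·ᵖ J d (suc m))) *ᵖ J (suc d) m))
    where

    J-const : ∀ d m → J d m 0 ≈ 1#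
    J-const zero    m = J-zero m 0
    J-const (suc d) m = ≈-trans (J-suc d m 0) (+-identityʳ _)

    -- t^h K h generates the paths from height h to 0, cut at the last visit to each height.
    K : ℕ → ℕ → ℕ → Carrier
    K zero    d = J d 0
    K (suc h) d = J d (suc h) *ᵖ K h (suc d)

    K-const : ∀ h d → K h d 0 ≈ 1#
    K-const zero    d = J-const d 0
    K-const (suc h) d = ≈-trans (*-cong (J-const d (suc h)) (K-const h (suc d))) (*-identityˡ _)

    -- Paths from height h whose first step is level or up. An up step also costs the extra t that
    -- passes from t^h to t^(h+1), hence the `tᵖ`. Height plus depth is constant along a path,
    -- because `J (suc d) m` refers to `J d (suc m)`.
    step : ∀ h d → (ℕ → Carrier) → ℕ → Carrier
    step h d f = c h ·ᵖ f +ᵖ tᵖ (b h ·ᵖ K (suc h) d)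

    step-* : ∀ a b f g → (constᵖ a +ᵖ tᵖ (b ·ᵖ f)) *ᵖ g ≈ᵖ a ·ᵖ g +ᵖ tᵖ (b ·ᵖ (f *ᵖ g))
    step-* a b f g n = ≈-trans (*ᵖ-distribʳ g (constᵖ a) (tᵖ (b ·ᵖ f)) n)
      (+-cong (constᵖ-* a g n) (≈-trans (tᵖ-* (b ·ᵖ f) g n) (tᵖ-cong (·ᵖ-*ᵖ b f g) n)))

    K-zero-suc : ∀ d n → K 0 (suc d) (suc n) ≈ step 0 d (K 0 (suc d)) n
    K-zero-suc d n = begin
      J (suc d) 0 (suc n)
        ≈⟨ ≈-trans (J-suc d 0 (suc n)) (+-identityˡ _) ⟩
      ((constᵖ (c 0) +ᵖ tᵖ (b 0 ·ᵖ J d 1)) *ᵖ J (suc d) 0) n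
        ≈⟨ step-* (c 0) (b 0) (J d 1) (J (suc d) 0) n ⟩
      step 0 d (K 0 (suc d)) n ∎

    -- Unfolding the leading factor of `K (suc h)` once separates the paths by their first step: the
    -- summand 1 is an immediate down step, the rest stays level or goes up.
    K-suc-suc : ∀ h d n → K (suc h) (suc d) (suc n) ≈
      K h (suc (suc d)) (suc n) + step (suc h) d (K (suc h) (suc d)) n
    K-suc-suc h d n = begin
      (Jₕ *ᵖ Kₕ) (suc n)
        ≈⟨ *ᵖ-cong (J-suc d (suc h)) (λ _ → ≈-refl) (suc n) ⟩
      ((1ᵖ +ᵖ tᵖ (g *ᵖ Jₕ)) *ᵖ Kₕ) (suc n)
        ≈⟨ *ᵖ-distribʳ Kₕ 1ᵖ (tᵖ (g *ᵖ Jₕ)) (suc n) ⟩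
      (1ᵖ *ᵖ Kₕ) (suc n) + (tᵖ (g *ᵖ Jₕ) *ᵖ Kₕ) (suc n)
        ≈⟨ +-cong (*ᵖ-identityˡ Kₕ (suc n)) (tᵖ-* (g *ᵖ Jₕ) Kₕ (suc n)) ⟩
      Kₕ (suc n) + ((g *ᵖ Jₕ) *ᵖ Kₕ) n
        ≈⟨ +-congˡ (*ᵖ-assoc g Jₕ Kₕ n) ⟩
      Kₕ (suc n) + (g *ᵖ K (suc h) (suc d)) n
        ≈⟨ +-congˡ (step-* (c (suc h)) (b (suc h)) (J d (suc (suc h))) (K (suc h) (suc d)) n) ⟩
      Kₕ (suc n) + step (suc h) d (K (suc h) (suc d)) n ∎
      where
      Jₕ = J (suc d) (suc h)
      Kₕ = K h (suc (suc d))
      g  = constᵖ (c (suc h)) +ᵖ tᵖ (b (suc h) ·ᵖ J d (suc (suc h)))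

    module Motzkin
      (u v : ℕ → Carrier) (uv : ∀ h → u h * v h ≈ b h)
      (X : ℕ → ℕ → Carrier)
      (X-start : X 0 0 ≈ 1#)
      (X-start₀ : ∀ h → X 0 (suc h) ≈ 0#)
      (X-bottom : ∀ s → X (suc s) 0 ≈ c 0 * X s 0 + v 0 * X s 1)
      (X-step : ∀ s h → X (suc s) (suc h) ≈
        u h * X s h + (c (suc h) * X s (suc h) + v (suc h) * X s (suc (suc h))))
      where

      -- The weight of the last up steps across the edges below height h, which no down step undoes.
      -- All other up steps pair off with down steps into factors u_h v_h.
      U : ℕ → Carrier
      U zero    = 1#
      U (suc h) = u h * U h

      X-below : ∀ s h → s < h → X s h ≈ 0#
      X-below zero    (suc h) _         = X-start₀ h
      X-below (suc s) (suc h) (s≤s s<h) = begin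
        X (suc s) (suc h)
          ≈⟨ X-step s h ⟩
        u h * X s h + (c (suc h) * X s (suc h) + v (suc h) * X s (suc (suc h)))
          ≈⟨ +-cong (vanish (X-below s h s<h)) (+-cong (vanish (X-below s (suc h) s<1+h))
               (vanish (X-below s (suc (suc h)) (ℕ.m<n⇒m<1+n s<1+h)))) ⟩
        0# + (0# + 0#)
          ≈⟨ ≈-trans (+-identityˡ _) (+-identityˡ _) ⟩
        0# ∎
        where
        s<1+h = ℕ.m<n⇒m<1+n s<h
        vanish : ∀ {a y} → y ≈ 0# → a * y ≈ 0#
        vanish y≈0 = ≈-trans (*-congˡ y≈0) (zeroʳ _)

      -- Reversing a path from 0 to h gives a path from h to 0, which `K` weights by `b` on up steps
      -- and 1 on down steps; `U h` is what the change of weights leaves over. A path with n steps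
      -- beyond the h forced ones rises less than n above h, so depth d ≥ n is exact. Induction on
      -- n, then on h.
      X≈K : ∀ n h d → n ≤ d → X (n +ℕ h) h ≈ U h * K h d n

      -- The two terms of the recurrence shared by height 0 and all other heights. The bound n ≤ d +
      -- 1 suffices, because `K (suc h) d` enters with index n - 1.
      level-up : ∀ n h d → n ≤ suc d →
        c h * X (n +ℕ h) h + v h * X (n +ℕ h) (suc h) ≈ U h * step h d (K h (suc d)) n
      level-up n h d n≤ = begin
        c h * X (n +ℕ h) h + v h * X (n +ℕ h) (suc h)
          ≈⟨ +-cong (*-congˡ (X≈K n h (suc d) n≤)) (up n n≤) ⟩
        c h * (U h * K h (suc d) n) + U h * tᵖ (b h ·ᵖ K (suc h) d) n
          ≈⟨ solve 4 (λ x y z w → x :* (y :* z) :+ y :* w := y :* (x :* z :+ w)) ≈-refl _ _ _ _ ⟩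
        U h * step h d (K h (suc d)) n ∎
        where
        up : ∀ n → n ≤ suc d → v h * X (n +ℕ h) (suc h) ≈ U h * tᵖ (b h ·ᵖ K (suc h) d) n
        up zero    _         = ≈-trans (*-congˡ (X-below h (suc h) (ℕ.n<1+n h))) (≈-trans (zeroʳ _) (≈-sym (zeroʳ _)))
        up (suc n) (s≤s n≤d) = begin
          v h * X (suc n +ℕ h) (suc h)       ≡⟨ cong (λ s → v h * X s (suc h)) (ℕ.+-suc n h) ⟨
          v h * X (n +ℕ suc h) (suc h)       ≈⟨ *-congˡ (X≈K n (suc h) d n≤d) ⟩
          v h * (u h * U h * K (suc h) d n)
            ≈⟨ solve 4 (λ x y z w → x :* (y :* z :* w) := z :* ((y :* x) :* w)) ≈-refl _ _ _ _ ⟩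
          U h * (u h * v h * K (suc h) d n)  ≈⟨ *-congˡ (*-congʳ (uv h)) ⟩
          U h * (b h * K (suc h) d n)        ∎

      X≈K zero zero d _ = ≈-trans X-start (≈-sym (≈-trans (*-identityˡ _) (J-const d 0)))
      X≈K zero (suc h) d _ = begin
        X (suc h) (suc h)
          ≈⟨ X-step h h ⟩
        u h * X h h + (c (suc h) * X h (suc h) + v (suc h) * X h (suc (suc h)))
          ≈⟨ +-cong (*-congˡ (X≈K zero h d z≤n)) (+-cong (*-congˡ (X-below h (suc h) (ℕ.n<1+n h)))
               (*-congˡ (X-below h (suc (suc h)) (ℕ.m<n⇒m<1+n (ℕ.n<1+n h))))) ⟩
        u h * (U h * K h d 0) + (c (suc h) * 0# + v (suc h) * 0#)
          ≈⟨ +-cong (*-congˡ (*-congˡ (K-const h d))) (+-cong (zeroʳ _) (zeroʳ _)) ⟩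
        u h * (U h * 1#) + (0# + 0#)
          ≈⟨ ≈-trans (+-congˡ (+-identityˡ _)) (≈-trans (+-identityʳ _) (≈-sym (*-assoc _ _ _))) ⟩
        u h * U h * 1#
          ≈⟨ *-congˡ (K-const (suc h) d) ⟨
        U (suc h) * K (suc h) d 0 ∎
      X≈K (suc n) zero (suc d) (s≤s n≤d) = begin
        X (suc (n +ℕ 0)) 0                               ≈⟨ X-bottom (n +ℕ 0) ⟩
        c 0 * X (n +ℕ 0) 0 + v 0 * X (n +ℕ 0) 1          ≈⟨ level-up n 0 d (ℕ.m≤n⇒m≤1+n n≤d) ⟩
        1# * step 0 d (K 0 (suc d)) n                    ≈⟨ *-congˡ (K-zero-suc d n) ⟨
        1# * K 0 (suc d) (suc n)                         ∎
      X≈K (suc n) (suc h) (suc d) (s≤s n≤d) = begin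
        X (suc (n +ℕ suc h)) (suc h)
          ≈⟨ X-step (n +ℕ suc h) h ⟩
        u h * X (n +ℕ suc h) h + (c (suc h) * X (n +ℕ suc h) (suc h) + v (suc h) * X (n +ℕ suc h) (suc (suc h)))
          ≈⟨ +-cong (*-congˡ (≈-trans (reflexive (cong (λ s → X s h) (ℕ.+-suc n h)))
                 (X≈K (suc n) h (suc (suc d)) (ℕ.m≤n⇒m≤1+n (s≤s n≤d)))))
               (level-up n (suc h) d (ℕ.m≤n⇒m≤1+n n≤d)) ⟩
        u h * (U h * K h (suc (suc d)) (suc n)) + U (suc h) * step (suc h) d (K (suc h) (suc d)) n
          ≈⟨ solve 4 (λ x y z w → x :* (y :* z) :+ x :* y :* w := x :* y :* (z :+ w)) ≈-refl _ _ _ _ ⟩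
        U (suc h) * (K h (suc (suc d)) (suc n) + step (suc h) d (K (suc h) (suc d)) n)
          ≈⟨ *-congˡ (K-suc-suc h d n) ⟨
        U (suc h) * K (suc h) (suc d) (suc n) ∎

      J≈X : ∀ n d → n ≤ d → J d 0 n ≈ X n 0
      J≈X n d n≤d = ≈-sym (begin
        X n 0           ≡⟨ cong (λ s → X s 0) (ℕ.+-identityʳ n) ⟨
        X (n +ℕ 0) 0    ≈⟨ X≈K n 0 d n≤d ⟩
        1# * J d 0 n    ≈⟨ *-identityˡ _ ⟩
        J d 0 n         ∎)

-- Sums over the list of permutations

module ListSum (R : CommutativeSemiring 0ℓ 0ℓ) where
  open CommutativeSemiring R hiding (zero) renaming (refl to ≈-refl; sym to ≈-sym; trans to ≈-trans)
  open Sum +-commutativeMonoid using (sum)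
  open CommutativeSemigroup +-commutativeSemigroup using (interchange; x∙yz≈y∙xz)

  ∑ˡ : {A : Set} → List A → (A → Carrier) → Carrier
  ∑ˡ []       f = 0#
  ∑ˡ (a ∷ xs) f = f a + ∑ˡ xs f

  ∑ˡ-cong : ∀ {A : Set} (xs : List A) {f g} → (∀ {a} → a ∈ xs → f a ≈ g a) → ∑ˡ xs f ≈ ∑ˡ xs g
  ∑ˡ-cong []       p = ≈-refl
  ∑ˡ-cong (a ∷ xs) p = +-cong (p (here refl)) (∑ˡ-cong xs (p ∘ there))

  ∑ˡ-+ : ∀ {A : Set} (xs : List A) f g → ∑ˡ xs (λ a → f a + g a) ≈ ∑ˡ xs f + ∑ˡ xs g
  ∑ˡ-+ []       f g = ≈-sym (+-identityˡ _)
  ∑ˡ-+ (a ∷ xs) f g = ≈-trans (+-congˡ (∑ˡ-+ xs f g)) (interchange _ _ _ _)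

  ∑ˡ-* : ∀ {A : Set} (xs : List A) c f → ∑ˡ xs (λ a → c * f a) ≈ c * ∑ˡ xs f
  ∑ˡ-* []       c f = ≈-sym (zeroʳ c)
  ∑ˡ-* (a ∷ xs) c f = ≈-trans (+-congˡ (∑ˡ-* xs c f)) (≈-sym (distribˡ _ _ _))

  ∑ˡ-zero : ∀ {A : Set} (xs : List A) → ∑ˡ xs (λ _ → 0#) ≈ 0#
  ∑ˡ-zero []       = ≈-refl
  ∑ˡ-zero (a ∷ xs) = ≈-trans (+-identityˡ _) (∑ˡ-zero xs)

  ∑ˡ-↭ : ∀ {A : Set} {xs ys : List A} f → xs ↭ ys → ∑ˡ xs f ≈ ∑ˡ ys f
  ∑ˡ-↭ f ↭.refl          = ≈-refl
  ∑ˡ-↭ f (↭.prep a p)    = +-congˡ (∑ˡ-↭ f p)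
  ∑ˡ-↭ f (↭.swap a b p)  = ≈-trans (+-congˡ (+-congˡ (∑ˡ-↭ f p))) (x∙yz≈y∙xz _ _ _)
  ∑ˡ-↭ f (↭.trans p q)   = ≈-trans (∑ˡ-↭ f p) (∑ˡ-↭ f q)

  ∑ˡ-cartesianProductWith : ∀ {A B C : Set} (g : A → B → C) xs ys f →
    ∑ˡ (cartesianProductWith g xs ys) f ≈ ∑ˡ xs (λ a → ∑ˡ ys (λ b → f (g a b)))
  ∑ˡ-cartesianProductWith g []       ys f = ≈-refl
  ∑ˡ-cartesianProductWith g (a ∷ xs) ys f =
    ≈-trans (∑ˡ-map-++ ys) (+-congˡ (∑ˡ-cartesianProductWith g xs ys f))
    where
    rest = cartesianProductWith g xs ys
    ∑ˡ-map-++ : ∀ ys → ∑ˡ (map (g a) ys ++ rest) f ≈ ∑ˡ ys (λ b → f (g a b)) + ∑ˡ rest f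
    ∑ˡ-map-++ []       = ≈-sym (+-identityˡ _)
    ∑ˡ-map-++ (b ∷ ys) = ≈-trans (+-congˡ (∑ˡ-map-++ ys)) (≈-sym (+-assoc _ _ _))

  ∑ˡ-tabulate : ∀ {A : Set} {n} (g : Fin n → A) f → ∑ˡ (tabulate g) f ≈ sum (f ∘ g)
  ∑ˡ-tabulate {n = zero}  g f = ≈-refl
  ∑ˡ-tabulate {n = suc n} g f = +-congˡ (∑ˡ-tabulate (g ∘ suc) f)

-- The permutations as a duplicate-free list

Inj : ∀ {m n} → (Fin m → Fin n) → Set
Inj f = ∀ i j → f i ≡ f j → i ≡ j

T-⇒⁺ : ∀ {a b} → (T a → T b) → T (not a ∨ b)
T-⇒⁺ {true}  p = p _
T-⇒⁺ {false} p = _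

T-⇒⁻ : ∀ {a b} → T (not a ∨ b) → T a → T b
T-⇒⁻ {true} p _ = p

=ᶠ⇒≡ : ∀ {n} (i j : Fin n) → T (i =ᶠ j) → i ≡ j
=ᶠ⇒≡ i j = toℕ-injective ∘ ℕ.≡ᵇ⇒≡ (toℕ i) (toℕ j)

≡⇒=ᶠ : ∀ {n} (i j : Fin n) → i ≡ j → T (i =ᶠ j)
≡⇒=ᶠ i j = ℕ.≡⇒≡ᵇ (toℕ i) (toℕ j) ∘ cong toℕ

T-allFin⁺ : ∀ {n} (p : Fin n → Bool) → (∀ i → T (p i)) → T (all p (allFin n))
T-allFin⁺ {n} p h = all⁻ p {xs = allFin n} (All.tabulate λ {i} _ → h i)

T-allFin⁻ : ∀ {n} (p : Fin n → Bool) → T (all p (allFin n)) → ∀ i → T (p i)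
T-allFin⁻ {n} p h i = All.lookup (all⁺ p (allFin n) h) (∈-allFin i)

isInjective⇒Inj : ∀ {n} (f : Fin n → Fin n) → T (isInjective n f) → Inj f
isInjective⇒Inj f p i j fi≡fj =
  =ᶠ⇒≡ i j (T-⇒⁻ (T-allFin⁻ _ (T-allFin⁻ _ p i) j) (≡⇒=ᶠ (f i) (f j) fi≡fj))

Inj⇒isInjective : ∀ {n} (f : Fin n → Fin n) → Inj f → T (isInjective n f)
Inj⇒isInjective f inj = T-allFin⁺ _ λ i → T-allFin⁺ _ λ j →
  T-⇒⁺ (≡⇒=ᶠ i j ∘ inj i j ∘ =ᶠ⇒≡ (f i) (f j))

-- Vectors rather than functions, so that pointwise equality gives equality and the list can be
-- shown free of duplicates; `perms n` is its image under `lookup`.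
permVecs : ∀ n → List (Vec (Fin n) n)
permVecs n = filterᵇ (λ v → isInjective n (lookup v)) (allVecs n n)

filterᵇ≡filter : ∀ {A : Set} (p : A → Bool) xs → filterᵇ p xs ≡ filter (T? ∘ p) xs
filterᵇ≡filter p []       = refl
filterᵇ≡filter p (a ∷ xs) with p a
... | true  = cong (a ∷_) (filterᵇ≡filter p xs)
... | false = filterᵇ≡filter p xs

concatMap-map : ∀ {A B C : Set} (f : A → B → C) xs ys →
  concatMap (λ a → map (f a) ys) xs ≡ cartesianProductWith f xs ys
concatMap-map f []       ys = refl
concatMap-map f (a ∷ xs) ys = cong (map (f a) ys ++_) (concatMap-map f xs ys)

allVecs-suc : ∀ n m → allVecs n (suc m) ≡ cartesianProductWith (flip _∷_) (allVecs n m) (allFin n)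
allVecs-suc n m = concatMap-map (flip _∷_) (allVecs n m) (allFin n)

allVecs-complete : ∀ {n m} (v : Vec (Fin n) m) → v ∈ allVecs n m
allVecs-complete []      = here refl
allVecs-complete (a ∷ v) = subst (a ∷ v ∈_) (sym (allVecs-suc _ _))
  (∈-cartesianProductWith⁺ (flip _∷_) (allVecs-complete v) (∈-allFin a))

allVecs-unique : ∀ n m → Unique (allVecs n m)
allVecs-unique n zero    = All.[] AllPairs.∷ AllPairs.[]
allVecs-unique n (suc m) = subst Unique (sym (allVecs-suc n m))
  (cartesianProductWith⁺ (flip _∷_) (λ eq → proj₂ (∷-injective eq) , proj₁ (∷-injective eq))
    (allVecs-unique n m) (allFin⁺ n))

isPerm? : ∀ {n} (v : Vec (Fin n) n) → Dec (T (isInjective n (lookup v)))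
isPerm? v = T? _

permVecs≡filter : ∀ n → permVecs n ≡ filter isPerm? (allVecs n n)
permVecs≡filter n = filterᵇ≡filter (λ v → isInjective n (lookup v)) (allVecs n n)

∈-permVecs⁺ : ∀ {n} {v : Vec (Fin n) n} → Inj (lookup v) → v ∈ permVecs n
∈-permVecs⁺ {n} {v} inj = subst (v ∈_) (sym (permVecs≡filter n))
  (∈-filter⁺ isPerm? (allVecs-complete v) (Inj⇒isInjective (lookup v) inj))

∈-permVecs⁻ : ∀ {n} {v : Vec (Fin n) n} → v ∈ permVecs n → Inj (lookup v)
∈-permVecs⁻ {n} {v} v∈ = isInjective⇒Inj (lookup v)
  (proj₂ (∈-filter⁻ isPerm? {xs = allVecs n n} (subst (v ∈_) (permVecs≡filter n) v∈)))

permVecs-unique : ∀ n → Unique (permVecs n)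
permVecs-unique n = subst Unique (sym (permVecs≡filter n)) (filter⁺ isPerm? (allVecs-unique n n))

-- Duplicate-free lists with the same members are rearrangements of each other. Each recursive
-- construction of permutations thus only has to be injective, valid and exhaustive.
permVecs-↭ : ∀ {A B : Set} {n} (f : A → B → Vec (Fin n) n) {xs ys} →
  Unique xs → Unique ys → (∀ {a a′ b b′} → f a b ≡ f a′ b′ → a ≡ a′ × b ≡ b′) →
  (∀ {a b} → b ∈ ys → a ∈ xs → Inj (lookup (f a b))) →
  (∀ w → Inj (lookup w) → ∃ λ a → ∃ λ b → a ∈ xs × b ∈ ys × w ≡ f a b) →
  permVecs n ↭ cartesianProductWith f xs ys
permVecs-↭ {n = n} f {xs} {ys} xs! ys! f-inj f-perm f-onto =
  ∼bag⇒↭ (unique∧set⇒bag (permVecs-unique n) (cartesianProductWith⁺ f f-inj xs! ys!) (mk⇔ fwd bwd))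
  where
  fwd : ∀ {w} → w ∈ permVecs n → w ∈ cartesianProductWith f xs ys
  fwd {w} w∈ with f-onto w (∈-permVecs⁻ w∈)
  ... | a , b , a∈ , b∈ , refl = ∈-cartesianProductWith⁺ f a∈ b∈
  bwd : ∀ {w} → w ∈ cartesianProductWith f xs ys → w ∈ permVecs n
  bwd w∈ with ∈-cartesianProductWith⁻ f xs ys w∈
  ... | a , b , a∈ , b∈ , refl = ∈-permVecs⁺ (f-perm b∈ a∈)

-- Punching out a missed value would inject `Fin (suc n)` into `Fin n`.
Inj⇒onto : ∀ {n} {f : Fin n → Fin n} → Inj f → ∀ j → ∃ λ i → f i ≡ j
Inj⇒onto {suc n} {f} inj j with any? (λ i → f i ≟ j)
... | yes p = p
... | no ∄  = contradiction
  (injective⇒≤ {f = λ i → punchOut (j≢f i)}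
    (λ {i} {i′} eq → inj i i′ (punchOut-injective (j≢f i) (j≢f i′) eq)))
  ℕ.1+n≰n
  where
  j≢f : ∀ i → j ≢ f i
  j≢f i j≡fi = ∄ (i , sym j≡fi)

lookup-ext : ∀ {A : Set} {n} {v w : Vec A n} → (∀ i → lookup v i ≡ lookup w i) → v ≡ w
lookup-ext {v = v} {w} p = trans (sym (tabulate∘lookup v)) (trans (tabulate-cong p) (tabulate∘lookup w))

-- Insertion of an entry into a permutation

data PunchView {n} (i : Fin (suc n)) : Fin (suc n) → Set where
  hole : PunchView i i
  away : ∀ k → PunchView i (punchIn i k)

punchView : ∀ {n} (i p : Fin (suc n)) → PunchView i p
punchView i p with i ≟ p
... | yes refl = hole
... | no i≢p   = subst (PunchView i) (punchIn-punchOut i≢p) (away (punchOut i≢p))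

-- On the permutation matrix this adds a row `i` and a column `j` that meet in a new 1; the relative
-- order of the old entries is kept.
insert : ∀ {m n} → Fin (suc m) → Fin (suc n) → Vec (Fin n) m → Vec (Fin (suc n)) (suc m)
insert i j v = insertAt (Vec.map (punchIn j) v) i j

module _ {m n} (i : Fin (suc m)) (j : Fin (suc n)) (v : Vec (Fin n) m) where

  lookup-insert : lookup (insert i j v) i ≡ j
  lookup-insert = insertAt-lookup _ i j

  lookup-insert-punchIn : ∀ k → lookup (insert i j v) (punchIn i k) ≡ punchIn j (lookup v k)
  lookup-insert-punchIn k = trans (insertAt-punchIn _ i j k) (lookup-map k (punchIn j) v)

  insert-Inj⁺ : Inj (lookup v) → Inj (lookup (insert i j v))
  insert-Inj⁺ inj p q eq with punchView i p | punchView i q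
  ... | hole   | hole   = refl
  ... | hole   | away k = contradiction
    (trans (sym (lookup-insert-punchIn k)) (trans (sym eq) lookup-insert)) (punchInᵢ≢i j _)
  ... | away k | hole   = contradiction
    (trans (sym (lookup-insert-punchIn k)) (trans eq lookup-insert)) (punchInᵢ≢i j _)
  ... | away k | away l = cong (punchIn i) (inj k l (punchIn-injective j _ _
    (trans (sym (lookup-insert-punchIn k)) (trans eq (lookup-insert-punchIn l)))))

  insert-Inj⁻ : Inj (lookup (insert i j v)) → Inj (lookup v)
  insert-Inj⁻ inj k l eq = punchIn-injective i k l (inj _ _
    (trans (lookup-insert-punchIn k) (trans (cong (punchIn j) eq) (sym (lookup-insert-punchIn l)))))

insert-position-injective : ∀ {m n} {i i′ : Fin (suc m)} (j : Fin (suc n)) {v v′ : Vec (Fin n) m} →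
  insert i j v ≡ insert i′ j v′ → i ≡ i′
insert-position-injective {i = i} {i′} j {v} {v′} eq with punchView i′ i
... | hole   = refl
... | away k = contradiction
  (trans (sym (lookup-insert-punchIn i′ j v′ k)) (trans (cong (λ w → lookup w i) (sym eq)) (lookup-insert i j v)))
  (punchInᵢ≢i j _)

insert-value-injective : ∀ {m n} (i : Fin (suc m)) {j j′ : Fin (suc n)} {v v′ : Vec (Fin n) m} →
  insert i j v ≡ insert i j′ v′ → j ≡ j′
insert-value-injective i {j} {j′} {v} {v′} eq =
  trans (sym (lookup-insert i j v)) (trans (cong (λ w → lookup w i) eq) (lookup-insert i j′ v′))

insert-injective : ∀ {m n} (i : Fin (suc m)) (j : Fin (suc n)) {v v′ : Vec (Fin n) m} →
  insert i j v ≡ insert i j v′ → v ≡ v′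
insert-injective i j {v} {v′} eq = lookup-ext λ k → punchIn-injective j _ _
  (trans (sym (lookup-insert-punchIn i j v k))
    (trans (cong (λ w → lookup w (punchIn i k)) eq) (lookup-insert-punchIn i j v′ k)))

remove : ∀ {n} (w : Vec (Fin (suc n)) (suc n)) → Inj (lookup w) → ∀ i → ∃ λ v → w ≡ insert i (lookup w i) v
remove w inj i = v , lookup-ext agree
  where
  j≢ : ∀ k → lookup w i ≢ lookup w (punchIn i k)
  j≢ k eq = punchInᵢ≢i i k (sym (inj _ _ eq))
  v = Vec.tabulate (λ k → punchOut (j≢ k))
  agree : ∀ p → lookup w p ≡ lookup (insert i (lookup w i) v) p
  agree p with punchView i p
  ... | hole   = sym (lookup-insert i _ v)
  ... | away k = sym (trans (lookup-insert-punchIn i _ v k)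
    (trans (cong (punchIn (lookup w i)) (lookup∘tabulate (λ k → punchOut (j≢ k)) k)) (punchIn-punchOut (j≢ k))))

-- Expansion of the permutation matrix along row `i`: the column of its entry is free.
permVecs-by-position : ∀ {n} (i : Fin (suc n)) →
  permVecs (suc n) ↭ cartesianProductWith (insert i) (allFin (suc n)) (permVecs n)
permVecs-by-position {n} i = permVecs-↭ (insert i) (allFin⁺ _) (permVecs-unique n)
  inj (λ {j} {v} v∈ _ → insert-Inj⁺ i j v (∈-permVecs⁻ v∈)) onto
  where
  inj : ∀ {j j′ v v′} → insert i j v ≡ insert i j′ v′ → j ≡ j′ × v ≡ v′
  inj eq with insert-value-injective i eq
  ... | refl = refl , insert-injective i _ eq
  onto : ∀ w → Inj (lookup w) → ∃ λ j → ∃ λ v → j ∈ allFin (suc n) × v ∈ permVecs n × w ≡ insert i j v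
  onto w w-inj with remove w w-inj i
  ... | v , eq = _ , v , ∈-allFin _ , ∈-permVecs⁺ (insert-Inj⁻ i _ v (subst (Inj ∘ lookup) eq w-inj)) , eq

-- Expansion along column `j`; the row comes from surjectivity.
permVecs-by-value : ∀ {n} (j : Fin (suc n)) →
  permVecs (suc n) ↭ cartesianProductWith (λ i → insert i j) (allFin (suc n)) (permVecs n)
permVecs-by-value {n} j = permVecs-↭ (λ i → insert i j) (allFin⁺ _) (permVecs-unique n)
  inj (λ {i} {v} v∈ _ → insert-Inj⁺ i j v (∈-permVecs⁻ v∈)) onto
  where
  inj : ∀ {i i′ v v′} → insert i j v ≡ insert i′ j v′ → i ≡ i′ × v ≡ v′
  inj eq with insert-position-injective j eq
  ... | refl = refl , insert-injective _ j eq
  onto : ∀ w → Inj (lookup w) → ∃ λ i → ∃ λ v → i ∈ allFin (suc n) × v ∈ permVecs n × w ≡ insert i j v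
  onto w w-inj with Inj⇒onto w-inj j
  ... | i , refl with remove w w-inj i
  ... | v , eq = i , v , ∈-allFin i , ∈-permVecs⁺ (insert-Inj⁻ i _ v (subst (Inj ∘ lookup) eq w-inj)) , eq

-- Non-record weak excedances

T-ext : ∀ {a b} → T a ⇔ T b → a ≡ b
T-ext {true}  {true}  e = refl
T-ext {true}  {false} e = ⊥-elim (to e _)
T-ext {false} {true}  e = ⊥-elim (from e _)
T-ext {false} {false} e = refl

T-false : ∀ {b} → ¬ T b → b ≡ false
T-false {true}  ¬t = contradiction _ ¬t
T-false {false} ¬t = refl

T-true : ∀ {b} → T b → b ≡ true
T-true {true} t = refl

T-not : ∀ {b} → T (not b) ⇔ (¬ T b)
T-not {true}  = mk⇔ (λ ()) (λ ¬t → ¬t _)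
T-not {false} = mk⇔ (λ _ ()) (λ _ → _)

T-<ᶠ : ∀ {n} {i j : Fin n} → T (i <ᶠ j) ⇔ (toℕ i < toℕ j)
T-<ᶠ {i = i} {j} = mk⇔ (ℕ.<ᵇ⇒< (toℕ i) (toℕ j)) ℕ.<⇒<ᵇ

T-anyFin⁺ : ∀ {n} (p : Fin n → Bool) i → T (p i) → T (any p (allFin n))
T-anyFin⁺ p i pi = any⁺ p (lose (∈-allFin i) pi)

T-anyFin⁻ : ∀ {n} (p : Fin n → Bool) → T (any p (allFin n)) → ∃ λ i → T (p i)
T-anyFin⁻ {n} p t with find (any⁻ p (allFin n) t)
... | i , _ , pi = i , pi

bit : Bool → ℕ
bit b = if b then 1 else 0

countᵇ-tabulate : ∀ {A : Set} {n} (p : A → Bool) (f : Fin n → A) →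
  countᵇ p (tabulate f) ≡ ℕΣ.sum (bit ∘ p ∘ f)
countᵇ-tabulate {n = zero}  p f = refl
countᵇ-tabulate {n = suc n} p f with p (f zero)
... | true  = cong suc (countᵇ-tabulate p (f ∘ suc))
... | false = countᵇ-tabulate p (f ∘ suc)

-- Equivalent to the condition counted by `wexx`: `smaller-value-later` turns a larger value before
-- a weak excedance into a full decreasing triple around it.
NonRecordWex : ∀ {n} → (Fin n → Fin n) → Fin n → Set
NonRecordWex σ p = toℕ p ≤ toℕ (σ p) × ∃ λ i → toℕ i < toℕ p × toℕ (σ p) < toℕ (σ i)

-- The preimages of the toℕ p smallest values lie before p and avoid i.
smaller-value-later : ∀ {n} {σ : Fin n → Fin n} → Inj σ → ∀ {i p} →
  toℕ p ≤ toℕ (σ p) → toℕ i < toℕ p → toℕ (σ p) < toℕ (σ i) →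
  ∃ λ k → toℕ p < toℕ k × toℕ (σ k) < toℕ (σ p)
smaller-value-later {n} {σ} σ-inj {i} {p} wex i<p σp<σi
  with any? (λ k → (toℕ p <? toℕ k) ×-dec (toℕ (σ k) <? toℕ (σ p)))
... | yes found = found
... | no ∄ = contradiction (Inj⇒onto τ-inj (fromℕ< i<p)) i-missed
  where
  pre : (y : Fin (toℕ p)) → ∃ λ k → σ k ≡ inject {i = p} y
  pre y = Inj⇒onto σ-inj (inject y)

  small : ∀ y → toℕ (σ (proj₁ (pre y))) < toℕ p
  small y = subst (_< toℕ p) (sym (trans (cong toℕ (proj₂ (pre y))) (toℕ-inject y))) (toℕ<n y)

  before : ∀ y → toℕ (proj₁ (pre y)) < toℕ p
  before y = ℕ.≤∧≢⇒< (ℕ.≮⇒≥ λ p<k → ∄ (_ , p<k , ℕ.<-≤-trans (small y) wex))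
    λ k≡p → ℕ.<⇒≱ (small y) (subst (λ q → toℕ p ≤ toℕ (σ q)) (sym (toℕ-injective k≡p)) wex)

  τ : Fin (toℕ p) → Fin (toℕ p)
  τ y = fromℕ< (before y)

  toℕ-τ : ∀ y → toℕ (τ y) ≡ toℕ (proj₁ (pre y))
  toℕ-τ y = toℕ-fromℕ< (before y)

  τ-inj : Inj τ
  τ-inj y z eq = toℕ-injective (trans (sym (toℕ-inject y)) (trans (cong toℕ y≡z) (toℕ-inject z)))
    where
    y≡z : inject {i = p} y ≡ inject z
    y≡z = trans (sym (proj₂ (pre y))) (trans
      (cong σ (toℕ-injective (trans (sym (toℕ-τ y)) (trans (cong toℕ eq) (toℕ-τ z))))) (proj₂ (pre z)))

  i-missed : ¬ ∃ λ y → τ y ≡ fromℕ< i<p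
  i-missed (y , eq) = ℕ.<⇒≱ (small y)
    (subst (λ q → toℕ p ≤ toℕ (σ q)) (sym k≡i) (ℕ.≤-trans wex (ℕ.<⇒≤ σp<σi)))
    where
    k≡i : proj₁ (pre y) ≡ i
    k≡i = toℕ-injective (trans (sym (toℕ-τ y)) (trans (cong toℕ eq) (toℕ-fromℕ< i<p)))

nrw : ∀ {n} → (Fin n → Fin n) → Fin n → Bool
nrw {n} σ p = isWex n σ p ∧ isMid321 n σ p

T-nrw : ∀ {n} {σ : Fin n → Fin n} → Inj σ → ∀ p → T (nrw σ p) ⇔ NonRecordWex σ p
T-nrw {n} {σ} σ-inj p = mk⇔ fwd bwd
  where
  fwd : T (nrw σ p) → NonRecordWex σ p
  fwd t with to T-∧ t
  ... | t₁ , t₂ with T-anyFin⁻ _ (proj₁ (to T-∧ t₂))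
  ... | i , t₃ with to T-∧ t₃
  ... | i<p , σp<σi = ℕ.≮⇒≥ (to T-not t₁ ∘ from T-<ᶠ) , i , to T-<ᶠ i<p , to T-<ᶠ σp<σi

  bwd : NonRecordWex σ p → T (nrw σ p)
  bwd (wex , i , i<p , σp<σi) with smaller-value-later σ-inj wex i<p σp<σi
  ... | k , p<k , σk<σp = from T-∧
    ( from T-not (λ t → ℕ.<⇒≱ (to T-<ᶠ t) wex)
    , from T-∧
      ( T-anyFin⁺ _ i (from T-∧ (from T-<ᶠ i<p , from T-<ᶠ σp<σi))
      , T-anyFin⁺ _ k (from T-∧ (from T-<ᶠ p<k , from T-<ᶠ σk<σp))))

-- Effect of an insertion on non-record weak excedances

toℕ-punchIn-< : ∀ {n} (i : Fin (suc n)) k → toℕ k < toℕ i → toℕ (punchIn i k) ≡ toℕ k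
toℕ-punchIn-< (suc i) zero    _         = refl
toℕ-punchIn-< (suc i) (suc k) (s≤s k<i) = cong suc (toℕ-punchIn-< i k k<i)

toℕ-punchIn-≥ : ∀ {n} (i : Fin (suc n)) k → toℕ i ≤ toℕ k → toℕ (punchIn i k) ≡ suc (toℕ k)
toℕ-punchIn-≥ zero    k       _         = refl
toℕ-punchIn-≥ (suc i) (suc k) (s≤s i≤k) = cong suc (toℕ-punchIn-≥ i k i≤k)

toℕ≤toℕ-punchIn : ∀ {n} (i : Fin (suc n)) k → toℕ k ≤ toℕ (punchIn i k)
toℕ≤toℕ-punchIn i k with ℕ.<-≤-connex (toℕ k) (toℕ i)
... | inj₁ k<i = ℕ.≤-reflexive (sym (toℕ-punchIn-< i k k<i))
... | inj₂ i≤k = ℕ.≤-trans (ℕ.n≤1+n _) (ℕ.≤-reflexive (sym (toℕ-punchIn-≥ i k i≤k)))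

toℕ-punchIn≤1+toℕ : ∀ {n} (i : Fin (suc n)) k → toℕ (punchIn i k) ≤ suc (toℕ k)
toℕ-punchIn≤1+toℕ i k with ℕ.<-≤-connex (toℕ k) (toℕ i)
... | inj₁ k<i = ℕ.≤-trans (ℕ.≤-reflexive (toℕ-punchIn-< i k k<i)) (ℕ.n≤1+n _)
... | inj₂ i≤k = ℕ.≤-reflexive (toℕ-punchIn-≥ i k i≤k)

punchIn-mono-< : ∀ {n} (i : Fin (suc n)) {k l} → toℕ k < toℕ l → toℕ (punchIn i k) < toℕ (punchIn i l)
punchIn-mono-< i k<l = ℕ.≰⇒> λ le → ℕ.<⇒≱ k<l (punchIn-cancel-≤ i _ _ le)

punchIn-cancel-< : ∀ {n} (i : Fin (suc n)) {k l} → toℕ (punchIn i k) < toℕ (punchIn i l) → toℕ k < toℕ l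
punchIn-cancel-< i lt = ℕ.≰⇒> λ le → ℕ.<⇒≱ lt (punchIn-mono-≤ i _ _ le)

-- Conditions under which the new entry changes the status of no old entry. It lies within the first
-- H rows and columns or on their border, while the old entries in the first H rows are weak
-- excedances with values not below `j`. Deciding a position uses H = h + 1, deciding a value uses H
-- = h.
module InsertBelow {n} (i j : Fin (suc n)) (v : Vec (Fin n) n) (H : ℕ)
  (i≤H : toℕ i ≤ H) (j≤H : toℕ j ≤ H)
  (low : ∀ p → toℕ p < H → toℕ p ≤ toℕ (lookup v p) × toℕ j ≤ toℕ (lookup v p))
  where

  σ  = lookup v
  σ′ = lookup (insert i j v)

  σ′-away : ∀ k → σ′ (punchIn i k) ≡ punchIn j (σ k)
  σ′-away = lookup-insert-punchIn i j v

  -- For p < H the value moves up by exactly one and the position by at most one. For p ≥ H the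
  -- position moves up by one; the value does so too, unless it lies below j ≤ H ≤ p, and then p is
  -- no weak excedance before or after.
  wex-insert : ∀ p → toℕ (punchIn i p) ≤ toℕ (punchIn j (σ p)) ⇔ (toℕ p ≤ toℕ (σ p))
  wex-insert p with ℕ.<-≤-connex (toℕ p) H
  ... | inj₁ p<H = mk⇔ (λ _ → proj₁ (low p p<H)) λ _ → ℕ.≤-trans (toℕ-punchIn≤1+toℕ i p)
    (subst (suc (toℕ p) ≤_) (sym (toℕ-punchIn-≥ j (σ p) (proj₂ (low p p<H)))) (s≤s (proj₁ (low p p<H))))
  ... | inj₂ H≤p with ℕ.<-≤-connex (toℕ (σ p)) (toℕ j)
  ...   | inj₂ j≤σp rewrite toℕ-punchIn-≥ i p (ℕ.≤-trans i≤H H≤p) | toℕ-punchIn-≥ j (σ p) j≤σp = mk⇔ s≤s⁻¹ s≤s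
  ...   | inj₁ σp<j rewrite toℕ-punchIn-≥ i p (ℕ.≤-trans i≤H H≤p) | toℕ-punchIn-< j (σ p) σp<j =
    mk⇔ (ℕ.≤-trans (ℕ.n≤1+n _)) λ le → contradiction (ℕ.≤-trans j≤H (ℕ.≤-trans H≤p le)) (ℕ.<⇒≱ σp<j)

  NonRecordWex-insert : ∀ p → NonRecordWex σ′ (punchIn i p) ⇔ NonRecordWex σ p
  NonRecordWex-insert p rewrite σ′-away p = mk⇔ fwd bwd
    where
    bwd : NonRecordWex σ p → _
    bwd (wex , k , k<p , σp<σk) = from (wex-insert p) wex , punchIn i k , punchIn-mono-< i k<p ,
      subst (λ q → _ < toℕ q) (sym (σ′-away k)) (punchIn-mono-< j σp<σk)

    fwd : _ → NonRecordWex σ p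
    fwd (wex′ , k′ , k′<p , lt) with to (wex-insert p) wex′ | punchView i k′
    ... | wex | away k = wex , k , punchIn-cancel-< i k′<p , punchIn-cancel-< j (subst (λ q → _ < toℕ q) (σ′-away k) lt)
    -- The new entry cannot be the larger value before p: this would give p ≤ σ p < j ≤ H, whereas
    -- `low` makes σ p at least j.
    ... | wex | hole = contradiction
      (proj₂ (low p (ℕ.<-≤-trans (ℕ.≤-<-trans wex σp<j) j≤H))) (ℕ.<⇒≱ σp<j)
      where
      σp<j : toℕ (σ p) < toℕ j
      σp<j = ℕ.≤-<-trans (toℕ≤toℕ-punchIn j (σ p)) (subst (λ q → _ < toℕ q) (lookup-insert i j v) lt)

  wexx-insert : Inj σ → wexx (suc n) σ′ ≡ bit (nrw σ′ i) +ℕ wexx n σ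
  wexx-insert inj = begin
    wexx (suc n) σ′
      ≡⟨ countᵇ-tabulate (nrw σ′) id ⟩
    ℕΣ.sum (bit ∘ nrw σ′)
      ≡⟨ ℕΣ.sum-remove {i = i} (bit ∘ nrw σ′) ⟩
    bit (nrw σ′ i) +ℕ ℕΣ.sum (bit ∘ nrw σ′ ∘ punchIn i)
      ≡⟨ cong (bit (nrw σ′ i) +ℕ_) (ℕΣ.sum-cong-≗ λ p → cong bit (same p)) ⟩
    bit (nrw σ′ i) +ℕ ℕΣ.sum (bit ∘ nrw σ)
      ≡⟨ cong (bit (nrw σ′ i) +ℕ_) (countᵇ-tabulate (nrw σ) id) ⟨
    bit (nrw σ′ i) +ℕ wexx n σ ∎
    where
    open ≡.≡-Reasoning
    inj′ = insert-Inj⁺ i j v inj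
    same : ∀ p → nrw σ′ (punchIn i p) ≡ nrw σ p
    same p = T-ext (mk⇔
      (from (T-nrw inj p) ∘ to (NonRecordWex-insert p) ∘ to (T-nrw inj′ (punchIn i p)))
      (from (T-nrw inj′ (punchIn i p)) ∘ from (NonRecordWex-insert p) ∘ to (T-nrw inj p)))

-- For a = b = h these encode the completions of a partial permutation with h open positions and h open values.
InitialAbove : ∀ {n} → ℕ → ℕ → Vec (Fin n) n → Set
InitialAbove a b v = ∀ i → toℕ i < a → b ≤ toℕ (lookup v i)

initialAbove? : ∀ {n} a b (v : Vec (Fin n) n) → Dec (InitialAbove a b v)
initialAbove? a b v = all? λ i → (toℕ i <? a) →-dec (b ≤? toℕ (lookup v i))

-- Position h + 1 is the first one after the open positions. Failing to become open, it takes one of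
-- the h + 1 open values, all of them below it, so it is no weak excedance. Deleting it lowers the
-- values at the h + 1 open positions by one and leaves h open values.
module DropInsert {n h} (i j : Fin (suc n)) (i≡ : toℕ i ≡ suc h) (v : Vec (Fin n) n) where

  w = insert i j v

  drop-large : suc h ≤ toℕ j →
    ¬ (InitialAbove (suc h) (suc h) w × ¬ InitialAbove (suc (suc h)) (suc h) w)
  drop-large j>h (above , ¬above′) = ¬above′ above′
    where
    above′ : InitialAbove (suc (suc h)) (suc h) w
    above′ q q≤ with ℕ.m≤n⇒m<n∨m≡n (s≤s⁻¹ q≤)
    ... | inj₁ q<   = above q q<
    ... | inj₂ q≡ with toℕ-injective (trans q≡ (sym i≡))
    ... | refl = subst (λ k → suc h ≤ toℕ k) (sym (lookup-insert i j v)) j>h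

  module _ (j≤h : toℕ j ≤ h) where

    drop-small : (InitialAbove (suc h) (suc h) w × ¬ InitialAbove (suc (suc h)) (suc h) w) ⇔
      InitialAbove (suc h) h v
    drop-small = mk⇔ fwd λ above → bwd above , missed
      where
      fwd : InitialAbove (suc h) (suc h) w × _ → InitialAbove (suc h) h v
      fwd (above , _) p p≤h = s≤s⁻¹ (ℕ.≤-trans
        (subst (λ k → suc h ≤ toℕ k) (lookup-insert-punchIn i j v p)
          (above (punchIn i p) (subst (_< suc h) (sym (toℕ-punchIn-< i p (subst (toℕ p <_) (sym i≡) p≤h))) p≤h)))
        (toℕ-punchIn≤1+toℕ j (lookup v p)))

      bwd : InitialAbove (suc h) h v → InitialAbove (suc h) (suc h) w
      bwd above q q≤h with punchView i q
      ... | hole   = contradiction i≡ (ℕ.<⇒≢ q≤h)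
      ... | away k = subst (suc h ≤_) (sym (trans (cong toℕ (lookup-insert-punchIn i j v k))
                       (toℕ-punchIn-≥ j (lookup v k) (ℕ.≤-trans j≤h h≤)))) (s≤s h≤)
        where
        h≤ = above k (ℕ.≤-<-trans (toℕ≤toℕ-punchIn i k) q≤h)

      missed : ¬ InitialAbove (suc (suc h)) (suc h) w
      missed above = ℕ.<⇒≱ (s≤s j≤h)
        (subst (λ k → suc h ≤ toℕ k) (lookup-insert i j v) (above i (s≤s (ℕ.≤-reflexive i≡))))

    wexx-drop : Inj (lookup v) → InitialAbove (suc h) h v → wexx (suc n) (lookup w) ≡ wexx n (lookup v)
    wexx-drop inj above = trans (wexx-insert inj)
      (cong (λ b → bit b +ℕ wexx n (lookup v)) (T-false (¬wex ∘ to (T-nrw (insert-Inj⁺ i j v inj) i))))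
      where
      open InsertBelow i j v (suc h) (ℕ.≤-reflexive i≡) (ℕ.m≤n⇒m≤1+n j≤h)
        (λ p p≤h → ℕ.≤-trans (s≤s⁻¹ p≤h) (above p p≤h) , ℕ.≤-trans j≤h (above p p≤h)) using (wexx-insert)
      ¬wex : ¬ NonRecordWex (lookup w) i
      ¬wex (wex , _) = ℕ.<⇒≱ (s≤s j≤h) (subst₂ _≤_ i≡ (cong toℕ (lookup-insert i j v)) wex)

-- Value h is the first one after the open values. Failing to become open, it sits in one of the h +
-- 1 open positions, so its position is at most h and it is a weak excedance. Deleting it leaves h
-- open positions and h open values.
module WexInsert {n h} (i j : Fin (suc n)) (j≡ : toℕ j ≡ h) (v : Vec (Fin n) n) where

  w = insert i j v

  wex-large : suc h ≤ toℕ i →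
    ¬ (InitialAbove (suc h) h w × ¬ InitialAbove (suc h) (suc h) w)
  wex-large i>h (above , ¬above′) = ¬above′ above′
    where
    above′ : InitialAbove (suc h) (suc h) w
    above′ q q≤h with punchView i q
    ... | hole   = contradiction q≤h (ℕ.≤⇒≯ i>h)
    ... | away k = ℕ.≤∧≢⇒< (above q q≤h) λ h≡ → punchInᵢ≢i j (lookup v k)
      (toℕ-injective (trans (cong toℕ (sym (lookup-insert-punchIn i j v k))) (trans (sym h≡) (sym j≡))))

  module _ (i≤h : toℕ i ≤ h) where

    wex-small : (InitialAbove (suc h) h w × ¬ InitialAbove (suc h) (suc h) w) ⇔ InitialAbove h h v
    wex-small = mk⇔ fwd λ above → bwd above , missed
      where
      fwd : InitialAbove (suc h) h w × _ → InitialAbove h h v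
      fwd (above , _) p p<h = ℕ.≮⇒≥ λ vp<h → ℕ.<⇒≱ vp<h
        (subst (h ≤_) (trans (cong toℕ (lookup-insert-punchIn i j v p))
            (toℕ-punchIn-< j (lookup v p) (subst (_ <_) (sym j≡) vp<h)))
          (above (punchIn i p) (s≤s (ℕ.≤-trans (toℕ-punchIn≤1+toℕ i p) p<h))))

      bwd : InitialAbove h h v → InitialAbove (suc h) h w
      bwd above q q≤h with punchView i q
      ... | hole   = ℕ.≤-reflexive (trans (sym j≡) (cong toℕ (sym (lookup-insert i j v))))
      ... | away k = subst (λ l → h ≤ toℕ l) (sym (lookup-insert-punchIn i j v k))
        (ℕ.≤-trans (above k k<h) (toℕ≤toℕ-punchIn j (lookup v k)))
        where
        k<h : toℕ k < h
        k<h = ℕ.≰⇒> λ h≤k → ℕ.<⇒≱ q≤h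
          (subst (suc h ≤_) (sym (toℕ-punchIn-≥ i k (ℕ.≤-trans i≤h h≤k))) (s≤s h≤k))

      missed : ¬ InitialAbove (suc h) (suc h) w
      missed above = ℕ.1+n≰n (subst (suc h ≤_) (trans (cong toℕ (lookup-insert i j v)) j≡) (above i (s≤s i≤h)))

    wexx-wex : Inj (lookup v) → InitialAbove h h v →
      wexx (suc n) (lookup w) ≡ bit (nrw (lookup w) i) +ℕ wexx n (lookup v)
    wexx-wex inj above = wexx-insert inj
      where
      open InsertBelow i j v h i≤h (ℕ.≤-reflexive j≡)
        (λ p p<h → ℕ.≤-trans (ℕ.<⇒≤ p<h) (above p p<h) , ℕ.≤-trans (ℕ.≤-reflexive j≡) (above p p<h)) using (wexx-insert)

nrw-insert-zero : ∀ {n} (j : Fin (suc n)) (v : Vec (Fin n) n) → Inj (lookup v) →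
  nrw (lookup (insert zero j v)) zero ≡ false
nrw-insert-zero j v inj = T-false λ t → case (to (T-nrw (insert-Inj⁺ zero j v inj) zero) t)
  where
  case : ¬ NonRecordWex (lookup (insert zero j v)) zero
  case (_ , _ , () , _)

-- Position 0 is another open position; its value is at least h before the insertion and so exceeds
-- h afterwards.
nrw-insert-suc : ∀ {n h} (i : Fin n) (j : Fin (suc n)) (v : Vec (Fin n) n) → Inj (lookup v) →
  toℕ j ≡ h → toℕ i < h → InitialAbove h h v →
  nrw (lookup (insert (suc i) j v)) (suc i) ≡ true
nrw-insert-suc {suc n} {h} i j v inj j≡ i<h above = T-true
  (from (T-nrw (insert-Inj⁺ (suc i) j v inj) (suc i)) (wex , zero , s≤s z≤n , bigger))
  where
  w = insert (suc i) j v
  wᵢ≡h : toℕ (lookup w (suc i)) ≡ h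
  wᵢ≡h = trans (cong toℕ (lookup-insert (suc i) j v)) j≡
  wex : suc (toℕ i) ≤ toℕ (lookup w (suc i))
  wex = subst (suc (toℕ i) ≤_) (sym wᵢ≡h) i<h
  h≤v₀ : h ≤ toℕ (lookup v zero)
  h≤v₀ = above zero (ℕ.≤-trans (s≤s z≤n) i<h)
  bigger : toℕ (lookup w (suc i)) < toℕ (lookup w zero)
  bigger = subst₂ _<_ (sym wᵢ≡h)
    (sym (trans (cong toℕ (lookup-insert-punchIn (suc i) j v zero))
      (toℕ-punchIn-≥ j (lookup v zero) (ℕ.≤-trans (ℕ.≤-reflexive j≡) h≤v₀)))) (s≤s h≤v₀)

-- Weighted sums for wexx and their recurrence

module Indicator (R : CommutativeSemiring 0ℓ 0ℓ) where
  open CommutativeSemiring R hiding (zero) renaming (refl to ≈-refl; sym to ≈-sym; trans to ≈-trans)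
  open Sum +-commutativeMonoid using (sum; sum-replicate-zero)
  open import Algebra.Definitions.RawMonoid +-rawMonoid using () renaming (_×_ to _⨯_) public

  κ : ℕ → Carrier
  κ m = m ⨯ 1#

  ⨯≈* : ∀ m a → m ⨯ a ≈ κ m * a
  ⨯≈* zero    a = ≈-sym (zeroˡ a)
  ⨯≈* (suc m) a = ≈-trans (+-cong (≈-sym (*-identityˡ a)) (⨯≈* m a)) (≈-sym (distribʳ _ _ _))

  [_]_ : ∀ {P : Set} → Dec P → Carrier → Carrier
  [ p? ] a = if does p? then a else 0#

  []-yes : ∀ {P : Set} (p? : Dec P) {a} → P → [ p? ] a ≈ a
  []-yes (yes _) p = ≈-refl
  []-yes (no ¬p) p = contradiction p ¬p

  []-no : ∀ {P : Set} (p? : Dec P) {a} → ¬ P → [ p? ] a ≈ 0#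
  []-no (yes p) ¬p = contradiction p ¬p
  []-no (no _)  ¬p = ≈-refl

  []-cong : ∀ {P Q : Set} (p? : Dec P) (q? : Dec Q) {a b} → P ⇔ Q → (Q → a ≈ b) → [ p? ] a ≈ [ q? ] b
  []-cong p? (yes q) e a≈b = ≈-trans ([]-yes p? (from e q)) (a≈b q)
  []-cong p? (no ¬q) e a≈b = []-no p? (¬q ∘ to e)

  -- The substitute for subtracting the sum over a subclass from the sum over the class.
  []-split : ∀ {P Q : Set} (p? : Dec P) (q? : Dec Q) {a} → (Q → P) →
    [ p? ] a ≈ [ p? ×-dec ¬? q? ] a + [ q? ] a
  []-split (yes p) (yes q) Q⇒P = ≈-sym (+-identityˡ _)
  []-split (yes p) (no ¬q) Q⇒P = ≈-sym (+-identityʳ _)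
  []-split (no ¬p) (yes q) Q⇒P = contradiction (Q⇒P q) ¬p
  []-split (no ¬p) (no ¬q) Q⇒P = ≈-sym (+-identityʳ _)

  []-* : ∀ {P : Set} (p? : Dec P) {a b} → [ p? ] (a * b) ≈ a * [ p? ] b
  []-* (yes p) = ≈-refl
  []-* (no ¬p) = ≈-sym (zeroʳ _)

  sum-[<] : ∀ N m a → m ≤ N → sum {N} (λ j → [ toℕ j <? m ] a) ≈ m ⨯ a
  sum-[<] N       zero    a _         = sum-replicate-zero N
  sum-[<] (suc N) (suc m) a (s≤s m≤N) = +-congˡ (sum-[<] N m a m≤N)

module WexxSum (R : CommutativeSemiring 0ℓ 0ℓ) (x : CommutativeSemiring.Carrier R) where
  open CommutativeSemiring R hiding (zero) renaming (refl to ≈-refl; sym to ≈-sym; trans to ≈-trans)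
  open import Algebra.Definitions.RawSemiring rawSemiring using (_^_)
  open Sum +-commutativeMonoid using (sum; sum-cong-≋)
  open import Relation.Binary.Reasoning.Setoid setoid
  open ListSum R
  open Indicator R

  weight : ∀ {n} → Vec (Fin n) n → Carrier
  weight {n} v = x ^ wexx n (lookup v)

  -- Two kinds of state occur: a = b, where a position is decided next, and a = b + 1, halfway,
  -- where the position has been read and value b is decided next.
  C : ℕ → ℕ → ℕ → Carrier
  C a b n = ∑ˡ (permVecs n) (λ v → [ initialAbove? a b v ] weight v)

  C-split : ∀ {a b a′ b′} n →
    (∀ v → InitialAbove {n} a′ b′ v → InitialAbove a b v) →
    C a b n ≈ ∑ˡ (permVecs n) (λ v → [ initialAbove? a b v ×-dec ¬? (initialAbove? a′ b′ v) ] weight v) + C a′ b′ n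
  C-split {a} {b} {a′} {b′} n imp = ≈-trans
    (∑ˡ-cong (permVecs n) (λ {v} _ → []-split (initialAbove? a b v) (initialAbove? a′ b′ v) (imp v)))
    (∑ˡ-+ (permVecs n) _ _)

  -- Position h + 1 either takes one of the h + 1 open values, adding nothing to wexx, or becomes
  -- open itself.
  C-position : ∀ {n h} → suc h ≤ n → C (suc h) (suc h) (suc n) ≈
    suc h ⨯ C (suc h) h n + C (suc (suc h)) (suc h) (suc n)
  C-position {n} {h} h<n = ≈-trans
    (C-split (suc n) (λ v above p p≤h → above p (ℕ.m<n⇒m<1+n p≤h))) (+-congʳ (begin
    ∑ˡ (permVecs (suc n)) rest
      ≈⟨ ∑ˡ-↭ rest (permVecs-by-position i) ⟩
    ∑ˡ (cartesianProductWith (insert i) (allFin (suc n)) (permVecs n)) rest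
      ≈⟨ ∑ˡ-cartesianProductWith (insert i) (allFin (suc n)) (permVecs n) rest ⟩
    ∑ˡ (allFin (suc n)) (λ j → ∑ˡ (permVecs n) (λ v → rest (insert i j v)))
      ≈⟨ ∑ˡ-tabulate {n = suc n} id (λ j → ∑ˡ (permVecs n) (λ v → rest (insert i j v))) ⟩
    sum {suc n} (λ j → ∑ˡ (permVecs n) (λ v → rest (insert i j v)))
      ≈⟨ sum-cong-≋ {suc n} inner ⟩
    sum {suc n} (λ j → [ toℕ j <? suc h ] C (suc h) h n)
      ≈⟨ sum-[<] (suc n) (suc h) _ (ℕ.m≤n⇒m≤1+n h<n) ⟩
    suc h ⨯ C (suc h) h n ∎))
    where
    i : Fin (suc n)
    i = fromℕ< (s≤s h<n)
    i≡ : toℕ i ≡ suc h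
    i≡ = toℕ-fromℕ< (s≤s h<n)
    rest? : (w : Vec (Fin (suc n)) (suc n)) → Dec _
    rest? w = initialAbove? (suc h) (suc h) w ×-dec ¬? (initialAbove? (suc (suc h)) (suc h) w)
    rest : Vec (Fin (suc n)) (suc n) → Carrier
    rest w = [ rest? w ] weight w
    inner : ∀ j → ∑ˡ (permVecs n) (λ v → rest (insert i j v)) ≈ [ toℕ j <? suc h ] C (suc h) h n
    inner j with ℕ.<-≤-connex (toℕ j) (suc h)
    ... | inj₁ (s≤s j≤h) = ≈-trans
      (∑ˡ-cong (permVecs n) λ {v} v∈ → []-cong (rest? (insert i j v)) (initialAbove? (suc h) h v)
        (DropInsert.drop-small i j i≡ v j≤h)
        (λ above → reflexive (cong (x ^_) (DropInsert.wexx-drop i j i≡ v j≤h (∈-permVecs⁻ v∈) above))))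
      (≈-sym ([]-yes (toℕ j <? suc h) (s≤s j≤h)))
    ... | inj₂ h<j = ≈-trans
      (∑ˡ-cong (permVecs n) λ {v} _ → []-no (rest? (insert i j v)) (DropInsert.drop-large i j i≡ v h<j))
      (≈-trans (∑ˡ-zero (permVecs n)) (≈-sym ([]-no (toℕ j <? suc h) (ℕ.≤⇒≯ h<j))))

  -- Value h either becomes open or goes to one of the h + 1 open positions. The leftmost makes it a
  -- record and costs no x; each of the other h costs one x.
  C-value : ∀ {n h} → h ≤ n → C (suc h) h (suc n) ≈
    (C h h n + h ⨯ (x * C h h n)) + C (suc h) (suc h) (suc n)
  C-value {n} {h} h≤n = ≈-trans
    (C-split (suc n) (λ v above p p≤h → ℕ.≤-trans (ℕ.n≤1+n h) (above p p≤h))) (+-congʳ (begin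
    ∑ˡ (permVecs (suc n)) rest
      ≈⟨ ∑ˡ-↭ rest (permVecs-by-value j) ⟩
    ∑ˡ (cartesianProductWith (λ i → insert i j) (allFin (suc n)) (permVecs n)) rest
      ≈⟨ ∑ˡ-cartesianProductWith (λ i → insert i j) (allFin (suc n)) (permVecs n) rest ⟩
    ∑ˡ (allFin (suc n)) (λ i → ∑ˡ (permVecs n) (λ v → rest (insert i j v)))
      ≈⟨ ∑ˡ-tabulate {n = suc n} id (λ i → ∑ˡ (permVecs n) (λ v → rest (insert i j v))) ⟩
    -- Position 0 is split off because it is the only one where value h is a record.
    ∑ˡ (permVecs n) (λ v → rest (insert zero j v)) + sum (λ i → ∑ˡ (permVecs n) (λ v → rest (insert (suc i) j v)))
      ≈⟨ +-cong inner-zero (≈-trans (sum-cong-≋ inner-suc) (sum-[<] n h _ h≤n)) ⟩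
    C h h n + h ⨯ (x * C h h n) ∎))
    where
    j : Fin (suc n)
    j = fromℕ< (s≤s h≤n)
    j≡ : toℕ j ≡ h
    j≡ = toℕ-fromℕ< (s≤s h≤n)
    rest? : (w : Vec (Fin (suc n)) (suc n)) → Dec _
    rest? w = initialAbove? (suc h) h w ×-dec ¬? (initialAbove? (suc h) (suc h) w)
    rest : Vec (Fin (suc n)) (suc n) → Carrier
    rest w = [ rest? w ] weight w
    inner-zero : ∑ˡ (permVecs n) (λ v → rest (insert zero j v)) ≈ C h h n
    inner-zero = ∑ˡ-cong (permVecs n) λ {v} v∈ → []-cong (rest? (insert zero j v)) (initialAbove? h h v)
      (WexInsert.wex-small zero j j≡ v z≤n)
      (λ above → reflexive (cong (x ^_) (trans (WexInsert.wexx-wex zero j j≡ v z≤n (∈-permVecs⁻ v∈) above)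
        (cong (λ b → bit b +ℕ wexx n (lookup v)) (nrw-insert-zero j v (∈-permVecs⁻ v∈))))))
    inner-suc : ∀ i → ∑ˡ (permVecs n) (λ v → rest (insert (suc i) j v)) ≈ [ toℕ i <? h ] (x * C h h n)
    inner-suc i with ℕ.<-≤-connex (toℕ i) h
    ... | inj₁ i<h = ≈-trans
      (∑ˡ-cong (permVecs n) λ {v} v∈ → ≈-trans
        ([]-cong (rest? (insert (suc i) j v)) (initialAbove? h h v) (WexInsert.wex-small (suc i) j j≡ v i<h)
          (λ above → reflexive (cong (x ^_) (trans (WexInsert.wexx-wex (suc i) j j≡ v i<h (∈-permVecs⁻ v∈) above)
            (cong (λ b → bit b +ℕ wexx n (lookup v)) (nrw-insert-suc i j v (∈-permVecs⁻ v∈) j≡ i<h above))))))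
        ([]-* (initialAbove? h h v)))
      (≈-trans (∑ˡ-* (permVecs n) x _) (≈-sym ([]-yes (toℕ i <? h) i<h)))
    ... | inj₂ h≤i = ≈-trans
      (∑ˡ-cong (permVecs n) λ {v} _ → []-no (rest? (insert (suc i) j v)) (WexInsert.wex-large (suc i) j j≡ v (s≤s h≤i)))
      (≈-trans (∑ˡ-zero (permVecs n)) (≈-sym ([]-no (toℕ i <? h) (ℕ.≤⇒≯ h≤i))))

  X : ℕ → ℕ → Carrier
  X s h = C h h (s +ℕ h)

  X-start₀ : ∀ h → X 0 (suc h) ≈ 0#
  X-start₀ h = ≈-trans (∑ˡ-cong (permVecs (suc h)) λ {v} _ → []-no (initialAbove? (suc h) (suc h) v)
      λ above → ℕ.<⇒≱ (toℕ<n (lookup v zero)) (above zero (s≤s z≤n)))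
    (∑ˡ-zero (permVecs (suc h)))

  open Solver R using (solve; _:=_; _:+_; _:*_; con)

  -- With no open value available, position 0 can only become open, so `C 0 0` is already the
  -- halfway state `C 1 0`.
  X-bottom : ∀ s → X (suc s) 0 ≈ X s 0 + X s 1
  X-bottom s = begin
    C 0 0 (suc (s +ℕ 0))
      ≈⟨ ∑ˡ-cong (permVecs (suc (s +ℕ 0))) (λ {v} _ → []-cong (initialAbove? 0 0 v) (initialAbove? 1 0 v)
           (mk⇔ (λ _ _ _ → z≤n) (λ _ _ ())) (λ _ → ≈-refl)) ⟩
    C 1 0 (suc (s +ℕ 0))
      ≈⟨ C-value {s +ℕ 0} z≤n ⟩
    (X s 0 + 0#) + C 1 1 (suc (s +ℕ 0))
      ≈⟨ +-cong (+-identityʳ _) (reflexive (cong (C 1 1) (sym (ℕ.+-suc s 0)))) ⟩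
    X s 0 + X s 1 ∎

  -- A position decision followed by a value decision. The coefficient of `X s (suc h)` collects two
  -- histories: h + 1 from closing the position and opening the value, and 1 + (h+1)x from opening
  -- the position and closing the value.
  X-step : ∀ s h → X (suc s) (suc h) ≈
    (κ (suc h) * (1# + κ h * x)) * X s h + ((κ (suc (suc h)) + κ (suc h) * x) * X s (suc h) + X s (suc (suc h)))
  X-step s h = begin
    C (suc h) (suc h) (suc (s +ℕ suc h))
      ≈⟨ C-position (ℕ.m≤n+m (suc h) s) ⟩
    suc h ⨯ C (suc h) h (s +ℕ suc h) + C (suc (suc h)) (suc h) (suc (s +ℕ suc h))
      ≈⟨ +-cong (≈-trans (⨯≈* (suc h) _) (*-congˡ B₀)) B₁ ⟩
    κ (suc h) * ((X s h + κ h * (x * X s h)) + X s (suc h)) +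
      ((X s (suc h) + κ (suc h) * (x * X s (suc h))) + X s (suc (suc h)))
      ≈⟨ solve 6 (λ k x a b c one →
           (one :+ k) :* ((a :+ k :* (x :* a)) :+ b) :+ ((b :+ (one :+ k) :* (x :* b)) :+ c)
           := ((one :+ k) :* (con 1 :+ k :* x)) :* a :+ ((con 1 :+ (one :+ k) :+ (one :+ k) :* x) :* b :+ c))
           ≈-refl (κ h) x (X s h) (X s (suc h)) (X s (suc (suc h))) 1# ⟩
    (κ (suc h) * (1# + κ h * x)) * X s h + ((κ (suc (suc h)) + κ (suc h) * x) * X s (suc h) + X s (suc (suc h))) ∎
    where
    B₀ : C (suc h) h (s +ℕ suc h) ≈ (X s h + κ h * (x * X s h)) + X s (suc h)
    B₀ = begin
      C (suc h) h (s +ℕ suc h)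
        ≡⟨ cong (C (suc h) h) (ℕ.+-suc s h) ⟩
      C (suc h) h (suc (s +ℕ h))
        ≈⟨ C-value (ℕ.m≤n+m h s) ⟩
      (X s h + h ⨯ (x * X s h)) + C (suc h) (suc h) (suc (s +ℕ h))
        ≈⟨ +-cong (+-congˡ (⨯≈* h _)) (reflexive (cong (C (suc h) (suc h)) (sym (ℕ.+-suc s h)))) ⟩
      (X s h + κ h * (x * X s h)) + X s (suc h) ∎
    B₁ : C (suc (suc h)) (suc h) (suc (s +ℕ suc h)) ≈
      (X s (suc h) + κ (suc h) * (x * X s (suc h))) + X s (suc (suc h))
    B₁ = begin
      C (suc (suc h)) (suc h) (suc (s +ℕ suc h))
        ≈⟨ C-value (ℕ.m≤n+m (suc h) s) ⟩
      (X s (suc h) + suc h ⨯ (x * X s (suc h))) + C (suc (suc h)) (suc (suc h)) (suc (s +ℕ suc h))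
        ≈⟨ +-cong (+-congˡ (⨯≈* (suc h) _)) (reflexive (cong (C (suc (suc h)) (suc (suc h))) (sym (ℕ.+-suc s (suc h))))) ⟩
      (X s (suc h) + κ (suc h) * (x * X s (suc h))) + X s (suc (suc h)) ∎

  X-start : X 0 0 ≈ 1#
  X-start = +-identityʳ 1#

  X-total : ∀ n → X n 0 ≈ ∑ˡ (permVecs n) weight
  X-total n = ≈-trans (reflexive (cong (C 0 0) (ℕ.+-identityʳ n)))
    (∑ˡ-cong (permVecs n) λ {v} _ → []-yes (initialAbove? 0 0 v) (λ _ _ → z≤n))

-- Cycle descents

iter-+ : ∀ {n} (σ : Fin n → Fin n) l m a → iter σ (l +ℕ m) a ≡ iter σ l (iter σ m a)
iter-+ σ zero    m a = refl
iter-+ σ (suc l) m a = cong σ (iter-+ σ l m a)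

iter-inj : ∀ {n} {σ : Fin n → Fin n} → Inj σ → ∀ m → Inj (iter σ m)
iter-inj σ-inj zero    a b eq = eq
iter-inj σ-inj (suc m) a b eq = iter-inj σ-inj m a b (σ-inj _ _ eq)

iter-collision : ∀ {n} (σ : Fin n → Fin n) a →
  ∃ λ s → ∃ λ t → s < t × t ≤ n × iter σ s a ≡ iter σ t a
iter-collision {n} σ a with pigeonhole (ℕ.n<1+n n) (λ (s : Fin (suc n)) → iter σ (toℕ s) a)
... | s , t , s<t , eq = toℕ s , toℕ t , s<t , toℕ≤pred[n] t , eq

-- Shows that the n iterates listed by `cycleOf` exhaust the orbit. Two of the iterates 0 to n
-- coincide, at s < t, so any exponent m ≥ n may be lowered by t - s.
iter-shorten : ∀ {n} (σ : Fin n → Fin n) a m → ∃ λ l → l < n × iter σ l a ≡ iter σ m a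
iter-shorten {n} σ a = <-rec _ go
  where
  go : ∀ m → (∀ {l} → l < m → ∃ λ k → k < n × iter σ k a ≡ iter σ l a) →
       ∃ λ k → k < n × iter σ k a ≡ iter σ m a
  go m rec with ℕ.<-≤-connex m n
  ... | inj₁ m<n = m , m<n , refl
  ... | inj₂ n≤m with iter-collision σ a
  ... | s , t , s<t , t≤n , eq with rec {m ∸ t +ℕ s} shorter
    where
    shorter : m ∸ t +ℕ s < m
    shorter = subst (m ∸ t +ℕ s <_) (ℕ.m∸n+n≡m (ℕ.≤-trans t≤n n≤m)) (ℕ.+-monoʳ-< (m ∸ t) s<t)
  ... | k , k<n , eq′ = k , k<n , (begin
    iter σ k a                     ≡⟨ eq′ ⟩
    iter σ (m ∸ t +ℕ s) a           ≡⟨ iter-+ σ (m ∸ t) s a ⟩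
    iter σ (m ∸ t) (iter σ s a)    ≡⟨ cong (iter σ (m ∸ t)) eq ⟩
    iter σ (m ∸ t) (iter σ t a)    ≡⟨ iter-+ σ (m ∸ t) t a ⟨
    iter σ (m ∸ t +ℕ t) a           ≡⟨ cong (λ l → iter σ l a) (ℕ.m∸n+n≡m (ℕ.≤-trans t≤n n≤m)) ⟩
    iter σ m a                     ∎)
    where open ≡.≡-Reasoning

-- From σ^s a = σ^t a with s < t, injectivity cancels σ^s, and a = σ^(t-s-1) (σ a).
iter-return : ∀ {n} {σ : Fin n → Fin n} → Inj σ → ∀ a → ∃ λ m → iter σ m (σ a) ≡ a
iter-return {σ = σ} σ-inj a with iter-collision σ a
... | s , t , s<t , _ , eq = m , trans (sym (commute m)) (iter-inj σ-inj s _ _ (begin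
    iter σ s (iter σ (suc m) a)  ≡⟨ iter-+ σ s (suc m) a ⟨
    iter σ (s +ℕ suc m) a         ≡⟨ cong (λ l → iter σ l a) (trans (ℕ.+-suc s m) (ℕ.m+[n∸m]≡n s<t)) ⟩
    iter σ t a                   ≡⟨ eq ⟨
    iter σ s a                   ∎))
  where
  open ≡.≡-Reasoning
  m = t ∸ suc s
  commute : ∀ m → σ (iter σ m a) ≡ iter σ m (σ a)
  commute zero    = refl
  commute (suc m) = cong σ (commute m)

NotMin : ∀ {n} → (Fin n → Fin n) → Fin n → Set
NotMin σ a = ∃ λ m → toℕ (iter σ m a) < toℕ a

T-notCycleMin : ∀ {n} (σ : Fin n → Fin n) a → T (notCycleMin n σ a) ⇔ NotMin σ a
T-notCycleMin {n} σ a = mk⇔ fwd bwd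
  where
  fwd : T (notCycleMin n σ a) → NotMin σ a
  fwd t with find (Any-map⁻ (any⁻ (_<ᶠ a) (cycleOf n σ a) t))
  ... | m , _ , lt = m , to T-<ᶠ lt
  bwd : NotMin σ a → T (notCycleMin n σ a)
  bwd (m , lt) with iter-shorten σ a m
  ... | l , l<n , eq = any⁺ (_<ᶠ a) (Any-map⁺ (lose (∈-upTo⁺ l<n)
    (from T-<ᶠ (subst (λ b → toℕ b < toℕ a) (sym eq) lt))))

-- Insertion of a new maximum into a cycle

transpose-fst : ∀ {n} (i j : Fin n) → transpose i j i ≡ j
transpose-fst i j rewrite dec-true (i ≟ i) refl = refl

transpose-snd : ∀ {n} (i j : Fin n) → transpose i j j ≡ i
transpose-snd i j with j ≟ i
... | yes j≡i = j≡i
... | no  _ rewrite dec-true (j ≟ j) refl = refl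

transpose-other : ∀ {n} (i j : Fin n) {k} → k ≢ i → k ≢ j → transpose i j k ≡ k
transpose-other i j {k} k≢i k≢j rewrite dec-false (k ≟ i) k≢i | dec-false (k ≟ j) k≢j = refl

punchIn-fromℕ : ∀ {n} (k : Fin n) → punchIn (fromℕ n) k ≡ inject₁ k
punchIn-fromℕ zero    = refl
punchIn-fromℕ (suc k) = cong suc (punchIn-fromℕ k)

module _ {n : ℕ} where

  top : Fin (suc n)
  top = fromℕ n

  fixTop : Vec (Fin n) n → Vec (Fin (suc n)) (suc n)
  fixTop = insert top top

  fixTop-inject₁ : ∀ v k → lookup (fixTop v) (inject₁ k) ≡ inject₁ (lookup v k)
  fixTop-inject₁ v k = trans (cong (lookup (fixTop v)) (sym (punchIn-fromℕ k)))
    (trans (lookup-insert-punchIn top top v k) (punchIn-fromℕ (lookup v k)))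

  fixTop-top : ∀ v {k} → lookup (fixTop v) k ≡ top → k ≡ top
  fixTop-top v {k} eq with view k
  ... | ‵fromℕ     = refl
  ... | ‵inject₁ k = contradiction (trans (sym eq) (fixTop-inject₁ v k)) fromℕ≢inject₁

  -- Inserts the new maximum between i and its image in the cycle of i; i = top makes it a fixed point.
  cycleInsert : Vec (Fin n) n → Fin (suc n) → Vec (Fin (suc n)) (suc n)
  cycleInsert v i = Vec.tabulate (lookup (fixTop v) ∘ transpose i top)

  lookup-cycleInsert : ∀ v i k → lookup (cycleInsert v i) k ≡ lookup (fixTop v) (transpose i top k)
  lookup-cycleInsert v i k = lookup∘tabulate (lookup (fixTop v) ∘ transpose i top) k

  cycleInsert-at : ∀ v i → lookup (cycleInsert v i) i ≡ top
  cycleInsert-at v i = trans (lookup-cycleInsert v i i)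
    (trans (cong (lookup (fixTop v)) (transpose-fst i top)) (lookup-insert top top v))

  cycleInsert-top : ∀ v i → lookup (cycleInsert v i) top ≡ lookup (fixTop v) i
  cycleInsert-top v i = trans (lookup-cycleInsert v i top) (cong (lookup (fixTop v)) (transpose-snd i top))

  cycleInsert-other : ∀ v i k → inject₁ k ≢ i → lookup (cycleInsert v i) (inject₁ k) ≡ inject₁ (lookup v k)
  cycleInsert-other v i k k≢i = trans (lookup-cycleInsert v i (inject₁ k))
    (trans (cong (lookup (fixTop v)) (transpose-other i top k≢i (fromℕ≢inject₁ ∘ sym))) (fixTop-inject₁ v k))

  transpose-inj : ∀ (i j : Fin (suc n)) → Inj (transpose i j)
  transpose-inj i j k l eq = trans (sym (transpose-inverse j i)) (trans (cong (transpose j i) eq) (transpose-inverse j i))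

  cycleInsert-Inj : ∀ v i → Inj (lookup v) → Inj (lookup (cycleInsert v i))
  cycleInsert-Inj v i inj k l eq = transpose-inj i top k l (insert-Inj⁺ top top v inj _ _
    (trans (sym (lookup-cycleInsert v i k)) (trans eq (lookup-cycleInsert v i l))))

  -- `i` is recovered as the preimage of the maximum; undoing the transposition then recovers `v`.
  cycleInsert-injective : ∀ {v v′ i i′} → cycleInsert v i ≡ cycleInsert v′ i′ → v ≡ v′ × i ≡ i′
  cycleInsert-injective {v} {v′} {i} {i′} eq = v≡v′ i≡i′ , i≡i′
    where
    i≡i′ : i ≡ i′
    i≡i′ = transpose-inj i′ top i i′ (trans
      (fixTop-top v′ (trans (sym (lookup-cycleInsert v′ i′ i))
        (trans (cong (λ w → lookup w i) (sym eq)) (cycleInsert-at v i))))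
      (sym (transpose-fst i′ top)))
    v≡v′ : i ≡ i′ → v ≡ v′
    v≡v′ refl = insert-injective top top (lookup-ext λ k → trans (sym (back v k))
      (trans (cong (λ w → lookup w (transpose top i k)) eq) (back v′ k)))
      where
      back : ∀ v k → lookup (cycleInsert v i) (transpose top i k) ≡ lookup (fixTop v) k
      back v k = trans (lookup-cycleInsert v i (transpose top i k)) (cong (lookup (fixTop v)) (transpose-inverse i top {k}))

  -- Precomposing `w` with the transposition of the maximum and its preimage makes the maximum a
  -- fixed point, which can be deleted.
  cycleInsert-onto : ∀ w → Inj (lookup w) → ∃ λ v → ∃ λ i → Inj (lookup v) × w ≡ cycleInsert v i
  cycleInsert-onto w inj with Inj⇒onto inj top
  ... | i , wᵢ≡top = v , i , insert-Inj⁻ top top v (subst (Inj ∘ lookup) w′≡ w′-inj) , lookup-ext agree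
    where
    w′ = Vec.tabulate (lookup w ∘ transpose top i)
    lookup-w′ : ∀ k → lookup w′ k ≡ lookup w (transpose top i k)
    lookup-w′ k = lookup∘tabulate (lookup w ∘ transpose top i) k
    w′-inj : Inj (lookup w′)
    w′-inj k l eq = transpose-inj top i k l (inj _ _ (trans (sym (lookup-w′ k)) (trans eq (lookup-w′ l))))
    w′-top : lookup w′ top ≡ top
    w′-top = trans (lookup-w′ top) (trans (cong (lookup w) (transpose-fst top i)) wᵢ≡top)
    removed = remove w′ w′-inj top
    v = proj₁ removed
    w′≡ : w′ ≡ fixTop v
    w′≡ = trans (proj₂ removed) (cong (λ j → insert top j v) w′-top)
    agree : ∀ k → lookup w k ≡ lookup (cycleInsert v i) k
    agree k = sym (begin
      lookup (cycleInsert v i) k                  ≡⟨ lookup-cycleInsert v i k ⟩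
      lookup (fixTop v) (transpose i top k)       ≡⟨ cong (λ u → lookup u (transpose i top k)) w′≡ ⟨
      lookup w′ (transpose i top k)               ≡⟨ lookup-w′ (transpose i top k) ⟩
      lookup w (transpose top i (transpose i top k)) ≡⟨ cong (lookup w) (transpose-inverse top i) ⟩
      lookup w k                                  ∎)
      where open ≡.≡-Reasoning

permVecs-by-cycle : ∀ n → permVecs (suc n) ↭ cartesianProductWith cycleInsert (permVecs n) (allFin (suc n))
permVecs-by-cycle n = permVecs-↭ cycleInsert (permVecs-unique n) (allFin⁺ _) cycleInsert-injective
  (λ {v} {i} _ v∈ → cycleInsert-Inj v i (∈-permVecs⁻ v∈)) onto
  where
  onto : ∀ w → Inj (lookup w) →
    ∃ λ v → ∃ λ i → v ∈ permVecs n × i ∈ allFin (suc n) × w ≡ cycleInsert v i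
  onto w inj with cycleInsert-onto w inj
  ... | v , i , v-inj , eq = v , i , ∈-permVecs⁺ v-inj , ∈-allFin i , eq

-- Change of exc and cdes under cycle insertion

isExc isCdes : ∀ {n} → (Fin n → Fin n) → Fin n → Bool
isExc σ k = k <ᶠ σ k
isCdes {n} σ k = (σ k <ᶠ k) ∧ notCycleMin n σ (σ k)

-- `nonexc` replaces n - exc, which would be a truncated subtraction; fixed points count here.
exc nonexc : ∀ {n} → (Fin n → Fin n) → ℕ
exc σ = ℕΣ.sum (bit ∘ isExc σ)
nonexc σ = ℕΣ.sum (bit ∘ not ∘ isExc σ)

cdes-sum : ∀ n (σ : Fin n → Fin n) → cdes n σ ≡ ℕΣ.sum (bit ∘ isCdes σ)
cdes-sum n σ = countᵇ-tabulate (isCdes σ) id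

-- The changed term is exchanged across the equation, since it cannot be subtracted.
sum-change : ∀ {n} (f g : Fin n → ℕ) a → (∀ k → k ≢ a → f k ≡ g k) → ℕΣ.sum f +ℕ g a ≡ ℕΣ.sum g +ℕ f a
sum-change {suc n} f g a f≡g = begin
  ℕΣ.sum f +ℕ g a                      ≡⟨ cong (_+ℕ g a) (ℕΣ.sum-remove {i = a} f) ⟩
  f a +ℕ ℕΣ.sum (f ∘ punchIn a) +ℕ g a  ≡⟨ cong (λ s → f a +ℕ s +ℕ g a) (ℕΣ.sum-cong-≗ λ k → f≡g _ (punchInᵢ≢i a k)) ⟩
  f a +ℕ ℕΣ.sum (g ∘ punchIn a) +ℕ g a  ≡⟨ swap (f a) _ (g a) ⟩
  g a +ℕ ℕΣ.sum (g ∘ punchIn a) +ℕ f a  ≡⟨ cong (_+ℕ f a) (ℕΣ.sum-remove {i = a} g) ⟨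
  ℕΣ.sum g +ℕ f a                      ∎
  where
  open ≡.≡-Reasoning
  open ℕ+ using () renaming (xy∙z≈zy∙x to swap)

module CycleInsert {n} (v : Vec (Fin n) n) (i : Fin (suc n)) where

  σ  = lookup v
  σ′ = lookup (cycleInsert v i)

  σ′-step : ∀ k → σ′ (inject₁ k) ≡ inject₁ (σ k) ⊎ (σ′ (inject₁ k) ≡ top × σ′ top ≡ inject₁ (σ k))
  σ′-step k with inject₁ k ≟ i
  ... | no k≢i   = inj₁ (cycleInsert-other v i k k≢i)
  ... | yes refl = inj₂ (cycleInsert-at v i , trans (cycleInsert-top v i) (fixTop-inject₁ v k))

  orbit-lift : ∀ b m → ∃ λ l → iter σ′ l (inject₁ b) ≡ inject₁ (iter σ m b)
  orbit-lift b zero = 0 , refl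
  orbit-lift b (suc m) with orbit-lift b m
  ... | l , eq with σ′-step (iter σ m b)
  ...   | inj₁ one         = suc l , trans (cong σ′ eq) one
  ...   | inj₂ (up , down) = suc (suc l) , trans (cong σ′ (trans (cong σ′ eq) up)) down

  -- The second alternative is a stop at the new maximum; it records which old element comes next,
  -- so that the induction can continue from there.
  orbit-project : ∀ b l →
    (∃ λ m → iter σ′ l (inject₁ b) ≡ inject₁ (iter σ m b)) ⊎
    (iter σ′ l (inject₁ b) ≡ top × ∃ λ m → σ′ top ≡ inject₁ (iter σ m b))
  orbit-project b zero = inj₁ (0 , refl)
  orbit-project b (suc l) with orbit-project b l
  ... | inj₂ (at-top , m , down) = inj₁ (m , trans (cong σ′ at-top) down)
  ... | inj₁ (m , eq) with σ′-step (iter σ m b)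
  ...   | inj₁ one         = inj₁ (suc m , trans (cong σ′ eq) one)
  ...   | inj₂ (up , down) = inj₂ (trans (cong σ′ eq) up , suc m , down)

  -- The orbits differ only by visits to the new maximum, which is never smaller than an old
  -- element.
  NotMin-lift : ∀ b → NotMin σ′ (inject₁ b) ⇔ NotMin σ b
  NotMin-lift b = mk⇔ fwd bwd
    where
    fwd : NotMin σ′ (inject₁ b) → NotMin σ b
    fwd (l , lt) with orbit-project b l
    ... | inj₁ (m , eq) = m , subst₂ _<_ (trans (cong toℕ eq) (toℕ-inject₁ _)) (toℕ-inject₁ b) lt
    ... | inj₂ (eq , _) = contradiction
      (subst₂ _<_ (trans (cong toℕ eq) (toℕ-fromℕ n)) (toℕ-inject₁ b) lt) (ℕ.<⇒≯ (toℕ<n b))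
    bwd : NotMin σ b → NotMin σ′ (inject₁ b)
    bwd (m , lt) with orbit-lift b m
    ... | l , eq = l , subst₂ _<_ (sym (trans (cong toℕ eq) (toℕ-inject₁ _))) (sym (toℕ-inject₁ b)) lt

  notCycleMin-lift : ∀ b → notCycleMin (suc n) σ′ (inject₁ b) ≡ notCycleMin n σ b
  notCycleMin-lift b = T-ext (mk⇔
    (from (T-notCycleMin σ b) ∘ to (NotMin-lift b) ∘ to (T-notCycleMin σ′ (inject₁ b)))
    (from (T-notCycleMin σ′ (inject₁ b)) ∘ from (NotMin-lift b) ∘ to (T-notCycleMin σ b)))

  <ᶠ-inject₁ : ∀ (k l : Fin n) → (inject₁ k <ᶠ inject₁ l) ≡ (k <ᶠ l)
  <ᶠ-inject₁ k l rewrite toℕ-inject₁ k | toℕ-inject₁ l = refl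

  inject₁<top : ∀ (k : Fin n) → (inject₁ k <ᶠ top) ≡ true
  inject₁<top k = T-true (from (T-<ᶠ {i = inject₁ k} {top}) (subst₂ _<_ (sym (toℕ-inject₁ k)) (sym (toℕ-fromℕ n)) (toℕ<n k)))

  top≮ : ∀ k → (top <ᶠ k) ≡ false
  top≮ k = T-false λ t → ℕ.<⇒≱ (subst (_< toℕ k) (toℕ-fromℕ n) (to (T-<ᶠ {i = top} {k}) t)) (toℕ≤pred[n] k)

  isCdes-other : ∀ k → inject₁ k ≢ i → isCdes σ′ (inject₁ k) ≡ isCdes σ k
  isCdes-other k k≢i rewrite cycleInsert-other v i k k≢i =
    cong₂ _∧_ (<ᶠ-inject₁ (σ k) k) (notCycleMin-lift (σ k))

  isExc-other : ∀ k → inject₁ k ≢ i → isExc σ′ (inject₁ k) ≡ isExc σ k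
  isExc-other k k≢i rewrite cycleInsert-other v i k k≢i = <ᶠ-inject₁ k (σ k)

  isExc-top : isExc σ′ top ≡ false
  isExc-top = top≮ (σ′ top)

module FixedPoint {n} (v : Vec (Fin n) n) where
  open CycleInsert v top

  other : ∀ (k : Fin n) → inject₁ k ≢ top
  other k = fromℕ≢inject₁ ∘ sym

  exc-fixed : exc σ′ ≡ exc σ
  exc-fixed = trans (ℕΣ.sum-init-last (bit ∘ isExc σ′)) (trans
    (cong₂ _+ℕ_ (ℕΣ.sum-cong-≗ λ k → cong bit (isExc-other k (other k))) (cong bit isExc-top)) (ℕ.+-identityʳ _))

  nonexc-fixed : nonexc σ′ ≡ suc (nonexc σ)
  nonexc-fixed = trans (ℕΣ.sum-init-last (bit ∘ not ∘ isExc σ′)) (trans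
    (cong₂ _+ℕ_ (ℕΣ.sum-cong-≗ λ k → cong (bit ∘ not) (isExc-other k (other k))) (cong (bit ∘ not) isExc-top))
    (ℕ.+-comm _ 1))

  cdes-fixed : cdes (suc n) σ′ ≡ cdes n σ
  cdes-fixed = begin
    cdes (suc n) σ′
      ≡⟨ cdes-sum (suc n) σ′ ⟩
    ℕΣ.sum (bit ∘ isCdes σ′)
      ≡⟨ ℕΣ.sum-init-last (bit ∘ isCdes σ′) ⟩
    ℕΣ.sum (bit ∘ isCdes σ′ ∘ inject₁) +ℕ bit (isCdes σ′ top)
      ≡⟨ cong₂ _+ℕ_ (ℕΣ.sum-cong-≗ λ k → cong bit (isCdes-other k (other k)))
           (cong (λ b → bit (b ∧ notCycleMin (suc n) σ′ (σ′ top))) σ′top≮) ⟩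
    ℕΣ.sum (bit ∘ isCdes σ) +ℕ 0
      ≡⟨ trans (ℕ.+-identityʳ _) (sym (cdes-sum n σ)) ⟩
    cdes n σ ∎
    where
    open ≡.≡-Reasoning
    σ′top≮ : (σ′ top <ᶠ top) ≡ false
    σ′top≮ = trans (cong (_<ᶠ top) (cycleInsert-at v top)) (top≮ top)

module After {n} (v : Vec (Fin n) n) (inj : Inj (lookup v)) (a : Fin n) where
  open CycleInsert v (inject₁ a)

  other : ∀ {k} → k ≢ a → inject₁ k ≢ inject₁ a
  other k≢a = k≢a ∘ inject₁-injective

  σ′-top : σ′ top ≡ inject₁ (σ a)
  σ′-top = trans (cycleInsert-top v (inject₁ a)) (fixTop-inject₁ v a)

  isExc-a : isExc σ′ (inject₁ a) ≡ true
  isExc-a = trans (cong (inject₁ a <ᶠ_) (cycleInsert-at v (inject₁ a))) (inject₁<top a)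

  isCdes-a : isCdes σ′ (inject₁ a) ≡ false
  isCdes-a = cong (_∧ notCycleMin (suc n) σ′ (σ′ (inject₁ a)))
    (trans (cong (_<ᶠ inject₁ a) (cycleInsert-at v (inject₁ a))) (top≮ (inject₁ a)))

  isCdes-top : isCdes σ′ top ≡ notCycleMin n σ (σ a)
  isCdes-top rewrite σ′-top | inject₁<top (σ a) = notCycleMin-lift (σ a)

  exc-after : exc σ′ +ℕ bit (isExc σ a) ≡ exc σ +ℕ 1
  exc-after = begin
    exc σ′ +ℕ bit (isExc σ a)
      ≡⟨ cong (_+ℕ bit (isExc σ a)) (trans (ℕΣ.sum-init-last (bit ∘ isExc σ′))
           (trans (cong (λ b → ℕΣ.sum (bit ∘ isExc σ′ ∘ inject₁) +ℕ bit b) isExc-top) (ℕ.+-identityʳ _))) ⟩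
    ℕΣ.sum (bit ∘ isExc σ′ ∘ inject₁) +ℕ bit (isExc σ a)
      ≡⟨ sum-change _ (bit ∘ isExc σ) a (λ k k≢a → cong bit (isExc-other k (other k≢a))) ⟩
    exc σ +ℕ bit (isExc σ′ (inject₁ a))
      ≡⟨ cong (λ b → exc σ +ℕ bit b) isExc-a ⟩
    exc σ +ℕ 1 ∎
    where open ≡.≡-Reasoning

  nonexc-after : nonexc σ′ +ℕ bit (not (isExc σ a)) ≡ nonexc σ +ℕ 1
  nonexc-after = begin
    nonexc σ′ +ℕ bit (not (isExc σ a))
      ≡⟨ cong (_+ℕ bit (not (isExc σ a))) (trans (ℕΣ.sum-init-last (bit ∘ not ∘ isExc σ′))
           (cong (λ b → s +ℕ bit (not b)) isExc-top)) ⟩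
    (s +ℕ 1) +ℕ bit (not (isExc σ a))
      ≡⟨ shuffle s 1 _ ⟩
    (s +ℕ bit (not (isExc σ a))) +ℕ 1
      ≡⟨ cong (_+ℕ 1) (sum-change _ (bit ∘ not ∘ isExc σ) a (λ k k≢a → cong (bit ∘ not) (isExc-other k (other k≢a)))) ⟩
    (nonexc σ +ℕ bit (not (isExc σ′ (inject₁ a)))) +ℕ 1
      ≡⟨ cong (_+ℕ 1) (trans (cong (λ b → nonexc σ +ℕ bit (not b)) isExc-a) (ℕ.+-identityʳ _)) ⟩
    nonexc σ +ℕ 1 ∎
    where
    open ≡.≡-Reasoning
    open ℕ+ using () renaming (xy∙z≈xz∙y to shuffle)
    s = ℕΣ.sum (bit ∘ not ∘ isExc σ′ ∘ inject₁)

  -- `a` now rises to the maximum and loses any cycle descent it had; the maximum falls to `σ a` and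
  -- gains one unless `σ a` is the least of its cycle.
  cdes-after : cdes (suc n) σ′ +ℕ bit (isCdes σ a) ≡ cdes n σ +ℕ bit (notCycleMin n σ (σ a))
  cdes-after = begin
    cdes (suc n) σ′ +ℕ bit (isCdes σ a)
      ≡⟨ cong (_+ℕ bit (isCdes σ a)) (trans (cdes-sum (suc n) σ′)
           (trans (ℕΣ.sum-init-last (bit ∘ isCdes σ′)) (cong (λ b → s +ℕ bit b) isCdes-top))) ⟩
    (s +ℕ t) +ℕ bit (isCdes σ a)
      ≡⟨ shuffle s t _ ⟩
    (s +ℕ bit (isCdes σ a)) +ℕ t
      ≡⟨ cong (_+ℕ t) (sum-change _ (bit ∘ isCdes σ) a (λ k k≢a → cong bit (isCdes-other k (other k≢a)))) ⟩
    (ℕΣ.sum (bit ∘ isCdes σ) +ℕ bit (isCdes σ′ (inject₁ a))) +ℕ t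
      ≡⟨ cong (_+ℕ t) (trans (cong (λ b → ℕΣ.sum (bit ∘ isCdes σ) +ℕ bit b) isCdes-a)
           (trans (ℕ.+-identityʳ _) (sym (cdes-sum n σ)))) ⟩
    cdes n σ +ℕ t ∎
    where
    open ≡.≡-Reasoning
    open ℕ+ using () renaming (xy∙z≈xz∙y to shuffle)
    s = ℕΣ.sum (bit ∘ isCdes σ′ ∘ inject₁)
    t = bit (notCycleMin n σ (σ a))

  -- An excedance has no cycle descent to lose, and `σ a` is not minimal because the smaller `a`
  -- lies in its cycle; so the fall from the maximum counts.
  after-exc : isExc σ a ≡ true →
    exc σ′ ≡ exc σ × nonexc σ′ ≡ suc (nonexc σ) × cdes (suc n) σ′ ≡ suc (cdes n σ)
  after-exc a<σa =
      ℕ.+-cancelʳ-≡ 1 _ _ (trans (cong (λ b → exc σ′ +ℕ bit b) (sym a<σa)) exc-after)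
    , trans (sym (ℕ.+-identityʳ _)) (trans (cong (λ b → nonexc σ′ +ℕ bit (not b)) (sym a<σa))
        (trans nonexc-after (ℕ.+-comm _ 1)))
    , trans (sym (ℕ.+-identityʳ _)) (trans (cong (λ b → cdes (suc n) σ′ +ℕ bit b) (sym not-drop))
        (trans cdes-after (trans (cong (λ b → cdes n σ +ℕ bit b) not-min) (ℕ.+-comm _ 1))))
    where
    lt : toℕ a < toℕ (σ a)
    lt = to (T-<ᶠ {i = a} {σ a}) (subst T (sym a<σa) _)
    not-drop : isCdes σ a ≡ false
    not-drop = T-false λ t → ℕ.<⇒≯ lt (to (T-<ᶠ {i = σ a} {a}) (proj₁ (to T-∧ t)))
    not-min : notCycleMin n σ (σ a) ≡ true
    not-min with iter-return inj a
    ... | m , eq = T-true (from (T-notCycleMin σ (σ a)) (m , subst (λ k → toℕ k < toℕ (σ a)) (sym eq) lt))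

  -- If σ a < a, the descent of `a` passes to the maximum with the same test on `σ a`. If `a` is
  -- fixed, it is the least of its cycle, and neither fall counts.
  after-nonexc : isExc σ a ≡ false →
    exc σ′ ≡ suc (exc σ) × nonexc σ′ ≡ nonexc σ × cdes (suc n) σ′ ≡ cdes n σ
  after-nonexc a≮σa =
      trans (sym (ℕ.+-identityʳ _)) (trans (cong (λ b → exc σ′ +ℕ bit b) (sym a≮σa)) (trans exc-after (ℕ.+-comm _ 1)))
    , ℕ.+-cancelʳ-≡ 1 _ _ (trans (cong (λ b → nonexc σ′ +ℕ bit (not b)) (sym a≮σa)) nonexc-after)
    , ℕ.+-cancelʳ-≡ (bit (isCdes σ a)) _ _ (trans cdes-after (cong (λ b → cdes n σ +ℕ bit b) same))
    where
    σa≤a : toℕ (σ a) ≤ toℕ a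
    σa≤a = ℕ.≮⇒≥ λ lt → subst T a≮σa (from (T-<ᶠ {i = a} {σ a}) lt)
    fixed-min : ∀ {b} → σ b ≡ b → ¬ NotMin σ b
    fixed-min {b} fix (m , lt) = ℕ.<-irrefl (cong toℕ (stays m)) lt
      where
      stays : ∀ m → iter σ m b ≡ b
      stays zero    = refl
      stays (suc m) = trans (cong σ (stays m)) fix
    same : notCycleMin n σ (σ a) ≡ isCdes σ a
    same with ℕ.m≤n⇒m<n∨m≡n σa≤a
    ... | inj₁ lt = cong (_∧ notCycleMin n σ (σ a)) (sym (T-true (from (T-<ᶠ {i = σ a} {a}) lt)))
    ... | inj₂ eq = trans
      (T-false (fixed-min (cong σ fix) ∘ to (T-notCycleMin σ (σ a))))
      (sym (cong (_∧ notCycleMin n σ (σ a)) (T-false λ t → ℕ.<⇒≢ (to (T-<ᶠ {i = σ a} {a}) t) eq)))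
      where
      fix : σ a ≡ a
      fix = toℕ-injective eq

-- The generating function for cdes

module Euler (S : CommutativeSemiring 0ℓ 0ℓ) where
  open CommutativeSemiring S renaming (refl to ≈-refl)
  open import Relation.Binary.Reasoning.Setoid setoid
  open Solver S using (solve; _:=_; _:+_; _:*_; con)

  -- The induction steps of `G-euler` with `D` for the derivative of `g`: the brackets on the left
  -- are the product rule for the factors p = 1 + z and q = 1 + az.
  euler-p : ∀ p q {D a k l g} → p * q * D ≈ k * (a * (p * g)) + l * (q * g) →
    p * q * (1# * g + p * D) ≈ k * (a * (p * (p * g))) + (1# + l) * (q * (p * g))
  euler-p p q {D} {a} {k} {l} {g} eq = begin
    p * q * (1# * g + p * D)
      ≈⟨ solve 4 (λ p q D g → p :* q :* (con 1 :* g :+ p :* D) := p :* q :* g :+ p :* (p :* q :* D)) ≈-refl p q D g ⟩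
    p * q * g + p * (p * q * D)
      ≈⟨ +-congˡ (*-congˡ eq) ⟩
    p * q * g + p * (k * (a * (p * g)) + l * (q * g))
      ≈⟨ solve 6 (λ p q a k l g → p :* q :* g :+ p :* (k :* (a :* (p :* g)) :+ l :* (q :* g))
           := k :* (a :* (p :* (p :* g))) :+ (con 1 :+ l) :* (q :* (p :* g))) ≈-refl p q a k l g ⟩
    k * (a * (p * (p * g))) + (1# + l) * (q * (p * g)) ∎

  euler-q : ∀ p q {D a k l g} → p * q * D ≈ k * (a * (p * g)) + l * (q * g) →
    p * q * (a * g + q * D) ≈ (1# + k) * (a * (p * (q * g))) + l * (q * (q * g))
  euler-q p q {D} {a} {k} {l} {g} eq = begin
    p * q * (a * g + q * D)
      ≈⟨ solve 5 (λ p q D a g → p :* q :* (a :* g :+ q :* D) := p :* q :* (a :* g) :+ q :* (p :* q :* D)) ≈-refl p q D a g ⟩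
    p * q * (a * g) + q * (p * q * D)
      ≈⟨ +-congˡ (*-congˡ eq) ⟩
    p * q * (a * g) + q * (k * (a * (p * g)) + l * (q * g))
      ≈⟨ solve 6 (λ p q a k l g → p :* q :* (a :* g) :+ q :* (k :* (a :* (p :* g)) :+ l :* (q :* g))
           := (con 1 :+ k) :* (a :* (p :* (q :* g))) :+ l :* (q :* (q :* g))) ≈-refl p q a k l g ⟩
    (1# + k) * (a * (p * (q * g))) + l * (q * (q * g)) ∎

  euler-cong : ∀ {p q a k l g h} → g ≈ h → k * (a * (p * g)) + l * (q * g) ≈ k * (a * (p * h)) + l * (q * h)
  euler-cong eq = +-cong (*-congˡ (*-congˡ (*-congˡ eq))) (*-congˡ (*-congˡ eq))

module CdesSum (R : CommutativeSemiring 0ℓ 0ℓ) (x : CommutativeSemiring.Carrier R) where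
  open CommutativeSemiring R hiding (zero) renaming (refl to ≈-refl; sym to ≈-sym; trans to ≈-trans)
  open import Algebra.Definitions.RawSemiring rawSemiring using (_^_)
  open Sum +-commutativeMonoid using (sum; sum-cong-≋; sum-init-last)
  open import Relation.Binary.Reasoning.Setoid setoid
  open Solver R using (solve; _:=_; _:+_; _:*_; con)
  open ListSum R
  open Indicator R
  open PowerSeries R

  module S where
    open CommutativeSemiring commutativeSemiring public
    open import Algebra.Definitions.RawSemiring (CommutativeSemiring.rawSemiring commutativeSemiring) using (_^_) public
    open Indicator commutativeSemiring using (κ) public
    open Solver commutativeSemiring using (solve; _:=_; _:*_) public

  lin : Carrier → ℕ → Carrier
  lin a zero    = 1#
  lin a (suc n) = constᵖ a n

  lin-* : ∀ a f → lin a *ᵖ f ≈ᵖ f +ᵖ tᵖ (a ·ᵖ f)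
  lin-* a f zero    = ≈-trans (*-identityˡ _) (≈-sym (+-identityʳ _))
  lin-* a f (suc n) = +-cong (*-identityˡ _) (constᵖ-* a f n)

  ∂ : (ℕ → Carrier) → ℕ → Carrier
  ∂ f n = κ (suc n) * f (suc n)

  ∂-cong : ∀ {f g} → f ≈ᵖ g → ∂ f ≈ᵖ ∂ g
  ∂-cong p n = *-congˡ (p (suc n))

  -- The product rule for a factor 1 + az, where it reduces to splitting n + 1 copies of a f_n into
  -- one copy and n copies.
  ∂-lin : ∀ a f → ∂ (lin a *ᵖ f) ≈ᵖ constᵖ a *ᵖ f +ᵖ lin a *ᵖ ∂ f
  ∂-lin a f n = begin
    κ (suc n) * (lin a *ᵖ f) (suc n)
      ≈⟨ *-congˡ (lin-* a f (suc n)) ⟩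
    κ (suc n) * (f (suc n) + a * f n)
      ≈⟨ rule n ⟩
    a * f n + (∂ f n + tᵖ (a ·ᵖ ∂ f) n)
      ≈⟨ +-cong (constᵖ-* a f n) (lin-* a (∂ f) n) ⟨
    (constᵖ a *ᵖ f) n + (lin a *ᵖ ∂ f) n ∎
    where
    rule : ∀ n → κ (suc n) * (f (suc n) + a * f n) ≈ a * f n + (∂ f n + tᵖ (a ·ᵖ ∂ f) n)
    rule zero = solve 3
      (λ a y z → (con 1 :+ con 0) :* (y :+ a :* z) := a :* z :+ ((con 1 :+ con 0) :* y :+ con 0))
      ≈-refl a (f 1) (f 0)
    rule (suc n) = solve 4
      (λ a k y z → (con 1 :+ k) :* (y :+ a :* z) := a :* z :+ ((con 1 :+ k) :* y :+ a :* (k :* z)))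
      ≈-refl a (κ (suc n)) (f (suc (suc n))) (f (suc n))

  p q x̂ : ℕ → Carrier
  p = lin 1#
  q = lin x
  x̂ = constᵖ x

  -- G e f h = [z^h] (1 + xz)^e (1 + z)^f
  G : ℕ → ℕ → ℕ → Carrier
  G e f = q S.^ e *ᵖ p S.^ f

  G-sucˡ : ∀ e f → G (suc e) f ≈ᵖ q *ᵖ G e f
  G-sucˡ e f = S.*-assoc q (q S.^ e) (p S.^ f)

  G-sucʳ : ∀ e f → G e (suc f) ≈ᵖ p *ᵖ G e f
  G-sucʳ e f = S.solve 3 (λ a b c → a S.:* (b S.:* c) S.:= b S.:* (a S.:* c)) S.refl (q S.^ e) p (p S.^ f)

  -- The logarithmic derivative ex/(1+xz) + f/(1+z) of `G e f`, cleared of denominators; by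
  -- induction, one factor at a time.
  G-euler : ∀ e f → p *ᵖ q *ᵖ ∂ (G e f) ≈ᵖ S.κ e *ᵖ (x̂ *ᵖ (p *ᵖ G e f)) +ᵖ S.κ f *ᵖ (q *ᵖ G e f)
  G-euler zero zero = S.trans (S.*-congˡ {p *ᵖ q} ∂1≈0) (S.trans (S.zeroʳ _)
    (S.sym (S.trans (S.+-cong (S.zeroˡ _) (S.zeroˡ _)) (S.+-identityˡ _))))
    where
    ∂1≈0 : ∂ (G 0 0) ≈ᵖ 0ᵖ
    ∂1≈0 n = ≈-trans (*-congˡ (S.*-identityˡ 1ᵖ (suc n))) (zeroʳ _)
  G-euler zero (suc f) = S.trans
    (S.*-congˡ {p *ᵖ q} (S.trans (∂-cong (G-sucʳ 0 f)) (∂-lin 1# (G 0 f))))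
    (S.trans (Euler.euler-p commutativeSemiring p q (G-euler zero f))
      (Euler.euler-cong commutativeSemiring (S.sym (G-sucʳ 0 f))))
  G-euler (suc e) f = S.trans
    (S.*-congˡ {p *ᵖ q} (S.trans (∂-cong (G-sucˡ e f)) (∂-lin x (G e f))))
    (S.trans (Euler.euler-q commutativeSemiring p q (G-euler e f))
      (Euler.euler-cong commutativeSemiring (S.sym (G-sucˡ e f))))

  κ-* : ∀ m f → S.κ m *ᵖ f ≈ᵖ κ m ·ᵖ f
  κ-* zero    f n = ≈-trans (S.zeroˡ f n) (≈-sym (zeroˡ _))
  κ-* (suc m) f n = begin
    ((1ᵖ +ᵖ S.κ m) *ᵖ f) n          ≈⟨ *ᵖ-distribʳ f 1ᵖ (S.κ m) n ⟩
    (1ᵖ *ᵖ f) n + (S.κ m *ᵖ f) n    ≈⟨ +-cong (constᵖ-* 1# f n) (κ-* m f n) ⟩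
    1# * f n + κ m * f n            ≈⟨ distribʳ _ _ _ ⟨
    κ (suc m) * f n                 ∎

  -- the operator (1 + z) + (1 + z)(1 + xz) ∂
  p-pq∂ : (ℕ → Carrier) → ℕ → Carrier
  p-pq∂ g = p *ᵖ g +ᵖ p *ᵖ q *ᵖ ∂ g

  -- The terms on the left are the insertions after an excedance, after a non-excedance, and as a
  -- fixed point.
  G-children : ∀ e f h → κ e * (x * G e (suc f) h) + κ f * G (suc e) f h + G e (suc f) h ≈ p-pq∂ (G e f) h
  G-children e f h = begin
    κ e * (x * G e (suc f) h) + κ f * G (suc e) f h + G e (suc f) h
      ≈⟨ +-cong (+-cong (*-congˡ (*-congˡ (G-sucʳ e f h))) (*-congˡ (G-sucˡ e f h))) (G-sucʳ e f h) ⟩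
    κ e * (x * (p *ᵖ G e f) h) + κ f * (q *ᵖ G e f) h + (p *ᵖ G e f) h
      ≈⟨ +-comm _ _ ⟩
    (p *ᵖ G e f) h + (κ e * (x * (p *ᵖ G e f) h) + κ f * (q *ᵖ G e f) h)
      ≈⟨ +-congˡ (+-cong (≈-trans (κ-* e (x̂ *ᵖ (p *ᵖ G e f)) h) (*-congˡ (constᵖ-* x (p *ᵖ G e f) h)))
           (κ-* f (q *ᵖ G e f) h)) ⟨
    (p *ᵖ G e f) h + ((S.κ e *ᵖ (x̂ *ᵖ (p *ᵖ G e f))) h + (S.κ f *ᵖ (q *ᵖ G e f)) h)
      ≈⟨ +-congˡ (G-euler e f h) ⟨
    p-pq∂ (G e f) h ∎

  p-pq∂-zero : ∀ g → p-pq∂ g 0 ≈ g 0 + g 1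
  p-pq∂-zero g = solve 2 (λ a b → con 1 :* a :+ con 1 :* con 1 :* ((con 1 :+ con 0) :* b) := a :+ b) ≈-refl (g 0) (g 1)

  -- Coefficient extraction with (1+z)(1+xz) = 1 + (1+x)z + xz². The middle coefficient is 1 +
  -- (1+x)(h+1), the 1 coming from the summand 1 + z of the operator.
  p-pq∂-suc : ∀ g h → p-pq∂ g (suc h) ≈
    (1# + κ h * x) * g h + ((κ (suc (suc h)) + κ (suc h) * x) * g (suc h) + κ (suc (suc h)) * g (suc (suc h)))
  p-pq∂-suc g h = begin
    (p *ᵖ g) (suc h) + (p *ᵖ q *ᵖ ∂ g) (suc h)
      ≈⟨ +-cong (lin-* 1# g (suc h)) (≈-trans (S.*-assoc p q (∂ g) (suc h)) (lin-* 1# (q *ᵖ ∂ g) (suc h))) ⟩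
    (g (suc h) + 1# * g h) + ((q *ᵖ ∂ g) (suc h) + 1# * (q *ᵖ ∂ g) h)
      ≈⟨ +-congˡ (+-cong (lin-* x (∂ g) (suc h)) (*-congˡ (≈-trans (lin-* x (∂ g) h) (+-congˡ (x∂ h))))) ⟩
    (g (suc h) + 1# * g h) + ((∂ g (suc h) + x * ∂ g h) + 1# * (∂ g h + x * (κ h * g h)))
      ≈⟨ solve 5 (λ x k a b c →
           (b :+ con 1 :* a) :+ (((con 1 :+ (con 1 :+ k)) :* c :+ x :* ((con 1 :+ k) :* b))
             :+ con 1 :* ((con 1 :+ k) :* b :+ x :* (k :* a)))
           := (con 1 :+ k :* x) :* a
             :+ ((con 1 :+ (con 1 :+ k) :+ (con 1 :+ k) :* x) :* b :+ (con 1 :+ (con 1 :+ k)) :* c))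
           ≈-refl x (κ h) (g h) (g (suc h)) (g (suc (suc h))) ⟩
    (1# + κ h * x) * g h + ((κ (suc (suc h)) + κ (suc h) * x) * g (suc h) + κ (suc (suc h)) * g (suc (suc h))) ∎
    where
    x∂ : ∀ h → tᵖ (x ·ᵖ ∂ g) h ≈ x * (κ h * g h)
    x∂ zero    = ≈-sym (≈-trans (*-congˡ (zeroˡ _)) (zeroʳ _))
    x∂ (suc h) = ≈-refl

  weight : ∀ {n} → ℕ → Vec (Fin n) n → Carrier
  weight {n} h v = x ^ cdes n (lookup v) * G (exc (lookup v)) (nonexc (lookup v)) h

  X : ℕ → ℕ → Carrier
  X n h = ∑ˡ (permVecs n) (weight h)

  sum-if : ∀ {n} (b : Fin n → Bool) y z → sum (λ a → if b a then y else z) ≈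
    κ (ℕΣ.sum (bit ∘ b)) * y + κ (ℕΣ.sum (bit ∘ not ∘ b)) * z
  sum-if {zero} b y z = ≈-sym (≈-trans (+-cong (zeroˡ _) (zeroˡ _)) (+-identityˡ _))
  sum-if {suc n} b y z with b zero | sum-if (b ∘ suc) y z
  ... | true  | ih = ≈-trans (+-congˡ ih)
    (solve 4 (λ y z k l → y :+ (k :* y :+ l :* z) := (con 1 :+ k) :* y :+ l :* z) ≈-refl y z _ _)
  ... | false | ih = ≈-trans (+-congˡ ih)
    (solve 4 (λ y z k l → z :+ (k :* y :+ l :* z) := k :* y :+ (con 1 :+ l) :* z) ≈-refl y z _ _)

  -- The last insertion place is the fixed point; the others contribute according to whether they
  -- are excedances, so only the numbers of the two kinds remain.
  weight-children : ∀ {n} h (v : Vec (Fin n) n) → Inj (lookup v) →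
    sum (λ i → weight h (cycleInsert v i)) ≈ x ^ cdes n (lookup v) * p-pq∂ (G (exc (lookup v)) (nonexc (lookup v))) h
  weight-children {n} h v inj = begin
    sum (λ i → weight h (cycleInsert v i))
      ≈⟨ sum-init-last (λ i → weight h (cycleInsert v i)) ⟩
    sum (λ a → weight h (cycleInsert v (inject₁ a))) + weight h (cycleInsert v (fromℕ n))
      ≈⟨ +-cong (≈-trans (sum-cong-≋ after) (sum-if (isExc σ) _ _)) fixed ⟩
    κ e * (x * x ^ c * G e (suc f) h) + κ f * (x ^ c * G (suc e) f h) + x ^ c * G e (suc f) h
      ≈⟨ solve 6 (λ k l x c g g′ → k :* (x :* c :* g) :+ l :* (c :* g′) :+ c :* g := c :* (k :* (x :* g) :+ l :* g′ :+ g))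
           ≈-refl (κ e) (κ f) x (x ^ c) (G e (suc f) h) (G (suc e) f h) ⟩
    x ^ c * (κ e * (x * G e (suc f) h) + κ f * G (suc e) f h + G e (suc f) h)
      ≈⟨ *-congˡ (G-children e f h) ⟩
    x ^ c * p-pq∂ (G e f) h ∎
    where
    σ = lookup v
    e = exc σ
    f = nonexc σ
    c = cdes n σ
    weight-≡ : ∀ (w : Vec (Fin (suc n)) (suc n)) {e f c} →
      exc (lookup w) ≡ e × nonexc (lookup w) ≡ f × cdes (suc n) (lookup w) ≡ c → weight h w ≈ x ^ c * G e f h
    weight-≡ w (refl , refl , refl) = ≈-refl
    fixed : weight h (cycleInsert v (fromℕ n)) ≈ x ^ c * G e (suc f) h
    fixed = weight-≡ (cycleInsert v (fromℕ n)) (exc-fixed , nonexc-fixed , cdes-fixed)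
      where open FixedPoint v
    after : ∀ a → weight h (cycleInsert v (inject₁ a)) ≈
      (if isExc σ a then x * x ^ c * G e (suc f) h else x ^ c * G (suc e) f h)
    after a with isExc σ a in eq
    ... | true  = weight-≡ (cycleInsert v (inject₁ a)) (After.after-exc v inj a eq)
    ... | false = weight-≡ (cycleInsert v (inject₁ a)) (After.after-nonexc v inj a eq)

  X-suc : ∀ n h → X (suc n) h ≈
    ∑ˡ (permVecs n) (λ v → x ^ cdes n (lookup v) * p-pq∂ (G (exc (lookup v)) (nonexc (lookup v))) h)
  X-suc n h = begin
    ∑ˡ (permVecs (suc n)) (weight h)
      ≈⟨ ∑ˡ-↭ (weight h) (permVecs-by-cycle n) ⟩
    ∑ˡ (cartesianProductWith cycleInsert (permVecs n) (allFin (suc n))) (weight h)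
      ≈⟨ ∑ˡ-cartesianProductWith cycleInsert (permVecs n) (allFin (suc n)) (weight h) ⟩
    ∑ˡ (permVecs n) (λ v → ∑ˡ (allFin (suc n)) (λ i → weight h (cycleInsert v i)))
      ≈⟨ ∑ˡ-cong (permVecs n) (λ {v} v∈ → ≈-trans
           (∑ˡ-tabulate {n = suc n} id (λ i → weight h (cycleInsert v i))) (weight-children h v (∈-permVecs⁻ v∈))) ⟩
    ∑ˡ (permVecs n) (λ v → x ^ cdes n (lookup v) * p-pq∂ (G (exc (lookup v)) (nonexc (lookup v))) h) ∎

  X-bottom : ∀ n → X (suc n) 0 ≈ X n 0 + X n 1
  X-bottom n = begin
    X (suc n) 0
      ≈⟨ X-suc n 0 ⟩
    ∑ˡ (permVecs n) (λ v → x ^ cdes n (lookup v) * p-pq∂ (G (exc (lookup v)) (nonexc (lookup v))) 0)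
      ≈⟨ ∑ˡ-cong (permVecs n) (λ {v} _ → ≈-trans
           (*-congˡ (p-pq∂-zero (G (exc (lookup v)) (nonexc (lookup v))))) (distribˡ _ _ _)) ⟩
    ∑ˡ (permVecs n) (λ v → weight 0 v + weight 1 v)
      ≈⟨ ∑ˡ-+ (permVecs n) (weight 0) (weight 1) ⟩
    X n 0 + X n 1 ∎

  X-step : ∀ n h → X (suc n) (suc h) ≈
    (1# + κ h * x) * X n h + ((κ (suc (suc h)) + κ (suc h) * x) * X n (suc h) + κ (suc (suc h)) * X n (suc (suc h)))
  X-step n h = begin
    X (suc n) (suc h)
      ≈⟨ X-suc n (suc h) ⟩
    ∑ˡ (permVecs n) (λ v → x ^ cdes n (lookup v) * p-pq∂ (G (exc (lookup v)) (nonexc (lookup v))) (suc h))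
      ≈⟨ ∑ˡ-cong (permVecs n) (λ {v} _ → ≈-trans
           (*-congˡ (p-pq∂-suc (G (exc (lookup v)) (nonexc (lookup v))) h))
           (solve 7 (λ y a b c r s t → y :* (a :* r :+ (b :* s :+ c :* t))
               := a :* (y :* r) :+ (b :* (y :* s) :+ c :* (y :* t)))
             ≈-refl _ u c₁ v₁ _ _ _)) ⟩
    ∑ˡ (permVecs n) (λ v → u * weight h v + (c₁ * weight (suc h) v + v₁ * weight (suc (suc h)) v))
      ≈⟨ ∑ˡ-+ (permVecs n) _ _ ⟩
    ∑ˡ (permVecs n) (λ v → u * weight h v) + ∑ˡ (permVecs n) (λ v → c₁ * weight (suc h) v + v₁ * weight (suc (suc h)) v)
      ≈⟨ +-cong (∑ˡ-* (permVecs n) u (weight h)) (≈-trans (∑ˡ-+ (permVecs n) _ _)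
           (+-cong (∑ˡ-* (permVecs n) c₁ (weight (suc h))) (∑ˡ-* (permVecs n) v₁ (weight (suc (suc h)))))) ⟩
    u * X n h + (c₁ * X n (suc h) + v₁ * X n (suc (suc h))) ∎
    where
    u  = 1# + κ h * x
    c₁ = κ (suc (suc h)) + κ (suc h) * x
    v₁ = κ (suc (suc h))

  X-start : X 0 0 ≈ 1#
  X-start = ≈-trans (+-identityʳ _) (≈-trans (*-identityˡ _) (*-identityˡ _))

  X-start₀ : ∀ h → X 0 (suc h) ≈ 0#
  X-start₀ h = ≈-trans (+-identityʳ _) (≈-trans (*-identityˡ _) (S.*-identityˡ 1ᵖ (suc h)))

  -- Setting z = 0 removes the auxiliary factors, so that height 0 carries the plain sum of x^cdes.
  G-const : ∀ e f → G e f 0 ≈ 1#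
  G-const e f = ≈-trans (*-cong (lin^ x e) (lin^ 1# f)) (*-identityˡ _)
    where
    lin^ : ∀ a m → (lin a S.^ m) 0 ≈ 1#
    lin^ a zero    = ≈-refl
    lin^ a (suc m) = ≈-trans (*-identityˡ _) (lin^ a m)

  X-total : ∀ n → X n 0 ≈ ∑ˡ (permVecs n) (λ v → x ^ cdes n (lookup v))
  X-total n = ∑ˡ-cong (permVecs n) λ {v} _ → ≈-trans
    (*-congˡ (G-const (exc (lookup v)) (nonexc (lookup v)))) (*-identityʳ _)

-- The continued fraction of the definitions

Σ≤-suc : ∀ n f → Σ≤ (suc n) f ≡ f 0 +ℕ Σ≤ n (f ∘ suc)
Σ≤-suc n f = cong (λ xs → f 0 +ℕ ListAction.sum xs)
  (trans (map-applyUpTo suc f (suc n)) (sym (map-upTo (f ∘ suc) (suc n))))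

Σ≤-cong : ∀ n {f g} → (∀ i → i ≤ n → f i ≡ g i) → Σ≤ n f ≡ Σ≤ n g
Σ≤-cong zero    p = cong (_+ℕ 0) (p 0 z≤n)
Σ≤-cong (suc n) {f} {g} p = begin
  Σ≤ (suc n) f            ≡⟨ Σ≤-suc n f ⟩
  f 0 +ℕ Σ≤ n (f ∘ suc)    ≡⟨ cong₂ _+ℕ_ (p 0 z≤n) (Σ≤-cong n (λ i i≤n → p (suc i) (s≤s i≤n))) ⟩
  g 0 +ℕ Σ≤ n (g ∘ suc)    ≡⟨ Σ≤-suc n g ⟨
  Σ≤ (suc n) g            ∎
  where open ≡.≡-Reasoning

Σ≤-zero : ∀ n → Σ≤ n (λ _ → 0) ≡ 0
Σ≤-zero zero    = refl
Σ≤-zero (suc n) = trans (Σ≤-suc n (λ _ → 0)) (Σ≤-zero n)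

Σ≤-truncate : ∀ {m n} f → m ≤ n → (∀ i → m < i → f i ≡ 0) → Σ≤ n f ≡ Σ≤ m f
Σ≤-truncate {zero}  {zero}  f _ _ = refl
Σ≤-truncate {zero}  {suc n} f _ f≡0 = trans (Σ≤-suc n f)
  (cong (f 0 +ℕ_) (trans (Σ≤-cong n (λ i _ → f≡0 (suc i) (s≤s z≤n))) (Σ≤-zero n)))
Σ≤-truncate {suc m} {suc n} f (s≤s m≤n) f≡0 = begin
  Σ≤ (suc n) f          ≡⟨ Σ≤-suc n f ⟩
  f 0 +ℕ Σ≤ n (f ∘ suc)  ≡⟨ cong (f 0 +ℕ_) (Σ≤-truncate (f ∘ suc) m≤n (λ i m<i → f≡0 (suc i) (s≤s m<i))) ⟩
  f 0 +ℕ Σ≤ m (f ∘ suc)  ≡⟨ Σ≤-suc m f ⟨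
  Σ≤ (suc m) f          ∎
  where open ≡.≡-Reasoning

-- Series in t over sequences of coefficients in x

module ℕˢ = PowerSeries ℕ.+-*-commutativeSemiring

-- Its elements are arbitrary coefficient sequences in x, so that `Series` is literally the type of
-- power series in t over it.
polynomials : CommutativeSemiring 0ℓ 0ℓ
polynomials = ℕˢ.commutativeSemiring

module Pol = CommutativeSemiring polynomials

open PowerSeries polynomials
module Ser = CommutativeSemiring commutativeSemiring

Σ≤-* : ∀ p q k → Σ≤ k (λ j → p j *ℕ q (k ∸ j)) ≡ (p Pol.* q) k
Σ≤-* p q zero    = ℕ.+-identityʳ _
Σ≤-* p q (suc k) = trans (Σ≤-suc k (λ j → p j *ℕ q (suc k ∸ j))) (cong (p 0 *ℕ q (suc k) +ℕ_) (Σ≤-* (p ∘ suc) q k))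

⊛≈*ᵖ : ∀ f g → f ⊛ g ≈ᵖ f *ᵖ g
⊛≈*ᵖ f g zero    k = trans (ℕ.+-identityʳ _) (Σ≤-* (f 0) (g 0) k)
⊛≈*ᵖ f g (suc n) k = trans
  (Σ≤-suc n (λ i → Σ≤ k (λ j → f i j *ℕ g (suc n ∸ i) (k ∸ j))))
  (cong₂ _+ℕ_ (Σ≤-* (f 0) (g (suc n)) k) (⊛≈*ᵖ (f ∘ suc) g n k))

oneS≈1ᵖ : oneS ≈ᵖ 1ᵖ
oneS≈1ᵖ zero    zero    = refl
oneS≈1ᵖ zero    (suc k) = refl
oneS≈1ᵖ (suc n) k       = refl

constS≈constᵖ : ∀ p → constS p ≈ᵖ constᵖ p
constS≈constᵖ p zero    k = refl
constS≈constᵖ p (suc n) k = refl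

*ᵖ-Σ≤ : ∀ N g (F : ℕ → Series) →
  g *ᵖ (λ n k → Σ≤ N (λ r → F r n k)) ≈ᵖ (λ n k → Σ≤ N (λ r → (g *ᵖ F r) n k))
*ᵖ-Σ≤ zero g F n k = trans
  (Ser.*-congˡ {g} (λ n k → ℕ.+-identityʳ (F 0 n k)) n k) (sym (ℕ.+-identityʳ _))
*ᵖ-Σ≤ (suc N) g F n k = begin
  (g *ᵖ (λ n k → Σ≤ (suc N) (λ r → F r n k))) n k
    ≡⟨ Ser.*-congˡ {g} (λ n k → Σ≤-suc N (λ r → F r n k)) n k ⟩
  (g *ᵖ (F 0 +ᵖ (λ n k → Σ≤ N (λ r → F (suc r) n k)))) n k
    ≡⟨ Ser.distribˡ g (F 0) (λ n k → Σ≤ N (λ r → F (suc r) n k)) n k ⟩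
  (g *ᵖ F 0) n k +ℕ (g *ᵖ (λ n k → Σ≤ N (λ r → F (suc r) n k))) n k
    ≡⟨ cong ((g *ᵖ F 0) n k +ℕ_) (*ᵖ-Σ≤ N g (F ∘ suc) n k) ⟩
  (g *ᵖ F 0) n k +ℕ Σ≤ N (λ r → (g *ᵖ F (suc r)) n k)
    ≡⟨ Σ≤-suc N (λ r → (g *ᵖ F r) n k) ⟨
  Σ≤ (suc N) (λ r → (g *ᵖ F r) n k) ∎
  where open ≡.≡-Reasoning

module _ (g g′ : Series) (g≈tg′ : g ≈ᵖ tᵖ g′) where

  powS-suc : ∀ r → powS g (suc r) ≈ᵖ tᵖ (g′ *ᵖ powS g r)
  powS-suc r = Ser.trans (⊛≈*ᵖ g (powS g r))
    (Ser.trans (Ser.*-congʳ g≈tg′) (tᵖ-* g′ (powS g r)))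

  -- Each factor `g` brings at least one t, so the r-th power starts at t^r. This is why the cut at
  -- r ≤ n in `inv1m` loses nothing.
  powS-vanish : ∀ r n → n < r → powS g r n Pol.≈ Pol.0#
  powS-vanish (suc r) zero    _         k = powS-suc r 0 k
  powS-vanish (suc r) (suc n) (s≤s n<r) k = begin
    powS g (suc r) (suc n) k  ≡⟨ powS-suc r (suc n) k ⟩
    (g′ *ᵖ powS g r) n k      ≡⟨ *ᵖ-cong-≤ g′ {powS g r} {0ᵖ} n (λ i i≤n → powS-vanish r i (ℕ.≤-<-trans i≤n n<r)) k ⟩
    (g′ *ᵖ 0ᵖ) n k            ≡⟨ Ser.zeroʳ g′ n k ⟩
    0                         ∎
    where open ≡.≡-Reasoning

  -- Passes from the truncated geometric series to the equation F = 1 + gF required by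
  -- `Convergents`.
  inv1m-unfold : inv1m g ≈ᵖ 1ᵖ +ᵖ tᵖ (g′ *ᵖ inv1m g)
  inv1m-unfold zero    k = cong (_+ℕ 0) (oneS≈1ᵖ 0 k)
  inv1m-unfold (suc n) k = begin
    Σ≤ (suc n) (λ r → powS g r (suc n) k)
      ≡⟨ Σ≤-suc n (λ r → powS g r (suc n) k) ⟩
    Σ≤ n (λ r → powS g (suc r) (suc n) k)
      ≡⟨ Σ≤-cong n (λ r _ → powS-suc r (suc n) k) ⟩
    Σ≤ n (λ r → (g′ *ᵖ powS g r) n k)
      ≡⟨ *ᵖ-Σ≤ n g′ (powS g) n k ⟨
    (g′ *ᵖ (λ i k → Σ≤ n (λ r → powS g r i k))) n k
      -- `inv1m` cuts the sum for t^i at r = i, while here it is cut at n for all i ≤ n; the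
      -- additional powers vanish.
      ≡⟨ *ᵖ-cong-≤ g′ n (λ i i≤n k → Σ≤-truncate (λ r → powS g r i k) i≤n (λ r i<r → powS-vanish r i i<r k)) k ⟩
    (g′ *ᵖ inv1m g) n k ∎
    where open ≡.≡-Reasoning

J-suc : ∀ d m → J (suc d) m ≈ᵖ
  1ᵖ +ᵖ tᵖ ((constᵖ (γ m) +ᵖ tᵖ (β (suc m) ·ᵖ J d (suc m))) *ᵖ J (suc d) m)
J-suc d m = inv1m-unfold _ (constᵖ (γ m) +ᵖ tᵖ (β (suc m) ·ᵖ J d (suc m))) λ where
    zero          k → refl
    (suc zero)    k → refl
    (suc (suc n)) k → trans (⊛≈*ᵖ (constS (β (suc m))) (J d (suc m)) n k)
      (trans (*ᵖ-cong {g = J d (suc m)} (constS≈constᵖ (β (suc m))) (λ _ _ → refl) n k)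
             (constᵖ-* (β (suc m)) (J d (suc m)) n k))

-- Specialisation to polynomials in x

open import Algebra.Definitions.RawSemiring Pol.rawSemiring using (_^_)
open ListSum polynomials
open Indicator polynomials using (κ)

x : ℕ → ℕ
x = ℕˢ.tᵖ ℕˢ.1ᵖ

x-* : ∀ f → x Pol.* f Pol.≈ ℕˢ.tᵖ f
x-* f zero    = refl
x-* f (suc k) = Pol.*-identityˡ f k

x^-coefficient : ∀ m k → (x ^ m) k ≡ bit (m ≡ᵇ k)
x^-coefficient zero    zero    = refl
x^-coefficient zero    (suc k) = refl
x^-coefficient (suc m) zero    = refl
x^-coefficient (suc m) (suc k) = trans (x-* (x ^ m) (suc k)) (x^-coefficient m k)

-- Each permutation contributes 1 to the coefficient of x^k exactly when its statistic equals k;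
-- with `permVecs n` the left side is `P n k` or `Q n k`.
countᵇ-coefficient : ∀ {n} (stat : (Fin n → Fin n) → ℕ) (vs : List (Vec (Fin n) n)) k →
  countᵇ (λ σ → stat σ ≡ᵇ k) (map lookup vs) ≡ ∑ˡ vs (λ v → x ^ stat (lookup v)) k
countᵇ-coefficient stat []       k = refl
countᵇ-coefficient stat (v ∷ vs) k with stat (lookup v) ≡ᵇ k | x^-coefficient (stat (lookup v)) k
... | true  | eq = cong₂ _+ℕ_ (sym eq) (countᵇ-coefficient stat vs k)
... | false | eq = cong₂ _+ℕ_ (sym eq) (countᵇ-coefficient stat vs k)

-- `γ` and `β` written with `κ` and `x`, as the recurrences produce them. The index of `b` is that
-- of `β` lowered by one, so that `b h` belongs to the edge between heights h and h + 1.
c b : ℕ → ℕ → ℕ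
c m = κ (suc m) Pol.+ κ m Pol.* x
b m = κ (suc m) Pol.* (Pol.1# Pol.+ κ m Pol.* x)

κ≈const : ∀ m → κ m Pol.≈ ℕˢ.constᵖ m
κ≈const zero    zero    = refl
κ≈const zero    (suc k) = refl
κ≈const (suc m) zero    = cong suc (κ≈const m 0)
κ≈const (suc m) (suc k) = κ≈const m (suc k)

κ-* : ∀ m f k → (κ m Pol.* f) k ≡ m *ℕ f k
κ-* m f k = trans (Pol.*-congʳ {f} (κ≈const m) k) (ℕˢ.constᵖ-* m f k)

γ≈c : ∀ m → γ m Pol.≈ c m
γ≈c m zero          = sym (trans (cong₂ _+ℕ_ (κ≈const (suc m) 0) (trans (κ-* m x 0) (ℕ.*-zeroʳ m))) (ℕ.+-identityʳ _))
γ≈c m (suc zero)    = sym (cong₂ _+ℕ_ (κ≈const (suc m) 1) (trans (κ-* m x 1) (ℕ.*-identityʳ m)))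
γ≈c m (suc (suc k)) = sym (cong₂ _+ℕ_ (κ≈const (suc m) (suc (suc k))) (trans (κ-* m x (suc (suc k))) (ℕ.*-zeroʳ m)))

β≈b : ∀ m → β (suc m) Pol.≈ b m
β≈b m k = sym (trans (κ-* (suc m) (Pol.1# Pol.+ κ m Pol.* x) k)
  (trans (cong (λ y → suc m *ℕ (Pol.1# k +ℕ y)) (κ-* m x k)) (case k)))
  where
  case : ∀ k → suc m *ℕ (Pol.1# k +ℕ m *ℕ x k) ≡ β (suc m) k
  case zero          = trans (cong (λ y → suc m *ℕ (1 +ℕ y)) (ℕ.*-zeroʳ m)) (ℕ.*-identityʳ (suc m))
  case (suc zero)    = cong (suc m *ℕ_) (ℕ.*-identityʳ m)
  case (suc (suc k)) = trans (cong (suc m *ℕ_) (ℕ.*-zeroʳ m)) (ℕ.*-zeroʳ (suc m))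

J-unfold : ∀ d m → J (suc d) m ≈ᵖ
  1ᵖ +ᵖ tᵖ ((constᵖ (c m) +ᵖ tᵖ (b m ·ᵖ J d (suc m))) *ᵖ J (suc d) m)
J-unfold d m = Ser.trans (J-suc d m) (Ser.+-congˡ {1ᵖ} (tᵖ-cong (Ser.*-congʳ {J (suc d) m}
  (Ser.+-cong (λ { zero → γ≈c m ; (suc n) k → refl }) (tᵖ-cong (λ n → Pol.*-congʳ {J d (suc m) n} (β≈b m)))))))

open JFraction polynomials
open Convergents c b J (λ m → oneS≈1ᵖ) J-unfold

open Solver polynomials using (solve; _:=_; _:+_; _:*_; con)

private
  module W = WexxSum polynomials x
  module D = CdesSum polynomials x

J≈wexx : ∀ n d → n ≤ d → J d 0 n Pol.≈ W.X n 0
J≈wexx = Motzkin.J≈X b (λ _ → Pol.1#) (λ h → Pol.*-identityʳ (b h)) W.X W.X-start W.X-start₀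
  (λ s → Pol.trans (W.X-bottom s)
    (solve 3 (λ x y z → y :+ z := (con 1 :+ con 0 :+ con 0 :* x) :* y :+ con 1 :* z)
      Pol.refl x (W.X s 0) (W.X s 1)))
  (λ s h → Pol.trans (W.X-step s h) (Pol.+-congˡ {b h Pol.* W.X s h} (Pol.+-congˡ {c (suc h) Pol.* W.X s (suc h)}
    (Pol.sym (Pol.*-identityˡ (W.X s (suc (suc h))))))))

J≈cdes : ∀ n d → n ≤ d → J d 0 n Pol.≈ D.X n 0
J≈cdes = Motzkin.J≈X (λ h → Pol.1# Pol.+ κ h Pol.* x) (κ ∘ suc)
  (λ h → Pol.*-comm (Pol.1# Pol.+ κ h Pol.* x) (κ (suc h)))
  D.X D.X-start D.X-start₀
  (λ s → Pol.trans (D.X-bottom s)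
    (solve 3 (λ x y z → y :+ z := (con 1 :+ con 0 :+ con 0 :* x) :* y :+ (con 1 :+ con 0) :* z)
      Pol.refl x (D.X s 0) (D.X s 1)))
  D.X-step

J≡P : (n d : ℕ) → n ≤ d → (k : ℕ) → J d 0 n k ≡ P n k
J≡P n d n≤d k = trans (J≈wexx n d n≤d k) (trans (W.X-total n k) (sym (countᵇ-coefficient (wexx n) (permVecs n) k)))

J≡Q : (n d : ℕ) → n ≤ d → (k : ℕ) → J d 0 n k ≡ Q n k
J≡Q n d n≤d k = trans (J≈cdes n d n≤d k) (trans (D.X-total n k) (sym (countᵇ-coefficient (cdes n) (permVecs n) k)))

theorem3p9 : ((n d : ℕ) → n ≤ d → (k : ℕ) → J d 0 n k ≡ P n k)
    × ((n d : ℕ) → n ≤ d → (k : ℕ) → J d 0 n k ≡ Q n k)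
    × ((n k : ℕ) → P n k ≡ Q n k)
theorem3p9 = J≡P , J≡Q , λ n k → trans (sym (J≡P n n ℕ.≤-refl k)) (J≡Q n n ℕ.≤-refl k)
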